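{- Let $H=(\square_i P_{n_i})\square(\square_j C_{m_j})$ be a finite Cartesian product of paths $P_{n_i}$ ($n_i\ge1$) and cycles $C_{m_j}$ ($m_j\ge3$). Then: (a) $\gamma(H)=\prod_i\gamma(P_{n_i})\prod_j\gamma(C_{m_j})$; in particular $\gamma(\square_i P_{n_i})=\prod_i(2^{n_i}-1)$ and $\gamma(\square_i C_{m_i})=\prod_i\bigl(2^{r_{m_i}}+2^{m_i-r_{m_i}+1}-3\bigr)$ where $r_{m_i}=\lceil m_i/2\rceil$; (b) $\gamma(H\square T)=\gamma(H)\gamma(T)$ for any tree $T$; (c) $\gamma(H\square K_n)=\gamma(H)\gamma(K_n)$ for the complete graph $K_n$.
   Context: All graphs are finite and connected; $P_n$ is the path on $n$ vertices, $C_m$ the cycle on $m$ vertices, $K_n$ the complete graph on $n$ vertices. A pebbling step removes two pebbles from a vertex and places one pebble on an adjacent vertex. The cover pebbling number $\gamma(G)$ is the minimum $N$ such that for every placement of $N$ pebbles on $G$ some sequence of pebbling steps leaves at least one pebble on every vertex. $G\square H$ is the Cartesian product: vertex set $V(G)\times V(H)$, with $(w,v)\sim(w',v')$ iff ($w=w'$ and $v\sim v'$) or ($v=v'$ and $w\sim w'$). -}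

module Defs where

open import Data.Nat using (ℕ; zero; suc; _+_; _*_; _∸_; _^_; _≤_; _<_; ⌈_/2⌉)
open import Data.Fin using (Fin; toℕ; remQuot; inject₁; fromℕ)
import Data.Fin as Fin
open import Data.List using (List; []; _∷_; foldr; map; tabulate)
open import Data.Nat.ListAction using (sum; product)
open import Data.Product using (Σ; ∃; _×_; _,_; proj₁; proj₂)
open import Data.Sum using (_⊎_)
open import Relation.Nullary using (¬_)
open import Relation.Binary.PropositionalEquality using (_≡_; _≢_)
open import Relation.Binary.Construct.Closure.ReflexiveTransitive using (Star)
open import Function.Definitions using (Injective)

record Graph : Set₁ where
  field
    size : ℕ
    _~_  : Fin size → Fin size → Set
open Graph public

IsSimple : Graph → Set
IsSimple G = (∀ u v → _~_ G u v → _~_ G v u) × (∀ u → ¬ (_~_ G u u))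

Connected : Graph → Set
Connected G = ∀ u v → Star (_~_ G) u v

HasCycle : Graph → Set
HasCycle G = Σ ℕ λ k → Σ (Fin (3 + k) → Fin (size G)) λ f →
  Injective _≡_ _≡_ f ×
  (∀ (i : Fin (2 + k)) → _~_ G (f (inject₁ i)) (f (Fin.suc i))) ×
  _~_ G (f (fromℕ (2 + k))) (f Fin.zero)

IsTree : Graph → Set
IsTree T = 1 ≤ size T × IsSimple T × Connected T × ¬ HasCycle T

Path : ℕ → Graph
Path n = record { size = n ; _~_ = λ i j → (suc (toℕ i) ≡ toℕ j) ⊎ (suc (toℕ j) ≡ toℕ i) }

CNext : (m : ℕ) → Fin m → Fin m → Set
CNext m i j = (suc (toℕ i) ≡ toℕ j) ⊎ ((suc (toℕ i) ≡ m) × (toℕ j ≡ 0))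

Cycle : ℕ → Graph
Cycle m = record { size = m ; _~_ = λ i j → CNext m i j ⊎ CNext m j i }

Complete : ℕ → Graph
Complete n = record { size = n ; _~_ = λ i j → i ≢ j }

infixl 6 _□_
_□_ : Graph → Graph → Graph
G □ H = record
  { size = size G * size H
  ; _~_  = λ x y →
      let (w , v)   = remQuot {size G} (size H) x
          (w' , v') = remQuot {size G} (size H) y
      in ((w ≡ w') × _~_ H v v') ⊎ ((v ≡ v') × _~_ G w w')
  }

□-list : List Graph → Graph
□-list = foldr _□_ (Complete 1)

Distribution : Graph → Set
Distribution G = Fin (size G) → ℕ

total : (G : Graph) → Distribution G → ℕ
total G D = sum (tabulate D)

PebStep : (G : Graph) → Distribution G → Distribution G → Set
PebStep G D D' = Σ (Fin (size G)) λ u → Σ (Fin (size G)) λ v →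
  _~_ G u v × 2 ≤ D u × D' u ≡ D u ∸ 2 × D' v ≡ suc (D v) ×
  (∀ w → w ≢ u → w ≢ v → D' w ≡ D w)

Reachable : (G : Graph) → Distribution G → Distribution G → Set
Reachable G = Star (PebStep G)

Covered : (G : Graph) → Distribution G → Set
Covered G D = ∀ v → 1 ≤ D v

CoverSolvable : Graph → ℕ → Set
CoverSolvable G N = ∀ (D : Distribution G) → total G D ≡ N →
  ∃ λ D' → Reachable G D D' × Covered G D'

IsCoverPebblingNumber : Graph → ℕ → Set
IsCoverPebblingNumber G k = CoverSolvable G k × (∀ N → N < k → ¬ CoverSolvable G N)

γPath : ℕ → ℕ
γPath n = 2 ^ n ∸ 1

γCycle : ℕ → ℕ
γCycle m = (2 ^ ⌈ m /2⌉ + 2 ^ (m ∸ ⌈ m /2⌉ + 1)) ∸ 3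

Hgraph : List ℕ → List ℕ → Graph
Hgraph ns ms = □-list (map Path ns) □ □-list (map Cycle ms)

{-# OPTIONS --safe #-}
-- The cover pebbling number is stackCost = ∑ₓ 2 ^ dist v x, maximised over v (Sjöstrand's cover pebbling theorem), and
-- stackCost is multiplicative on Cartesian products because distances add up.  Fewer pebbles stacked on v do not
-- suffice, since ∑ₓ D x * 2 ^ dist v x never increases.
--
-- For sufficiency, every covering pebble carries the number val x of initial pebbles spent on it, and
-- val x ≤ 2 ^ dist h x is kept for every fat vertex h (one with excess pebbles).  Take a closest pair of a fat
-- vertex f and an empty vertex t, at distance d, and push the excess of f along a geodesic to t.  At its j-th vertex y,
-- if another fat vertex h has distance j from y, then h takes over the route from y on together with the pebbles
-- collected at y; otherwise the pebbles at y are paired up and a left-over one, worth 2 ^ j, is charged to val y, which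
-- every other fat vertex tolerates, being at distance > j.  Either 2 ^ d pebbles reach t as one, or the excess of all heads
-- is wasted; if no fat vertex were left then, the last head v would have ∑ val < stackCost v.
module Submission where

open import Defs
open import Data.Nat
open import Data.Nat.Properties
open import Algebra.Properties.CommutativeSemigroup +-commutativeSemigroup using (interchange; x∙yz≈y∙xz; xy∙z≈xz∙y; xy∙z≈y∙xz)
open import Data.Nat.ListAction using (sum; product)
open import Data.Nat.Tactic.RingSolver using (solve-∀)
open import Data.Fin as Fin using (Fin; toℕ)
import Data.Fin.Properties as Finₚ
open import Data.Fin.Properties using (any?)
open import Data.List using (List; []; _∷_; length; lookup; map; tabulate; replicate; _++_)
open import Data.List.Membership.Propositional using (_∈_; _∉_)
import Data.List.Membership.DecPropositional as DecMembership
open import Data.List.Membership.Propositional.Properties using (∈-lookup)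
open import Data.List.Relation.Unary.All as All using (All; []; _∷_)
open import Data.List.Relation.Unary.Any using (here; there)
open import Data.Product using (∃; ∃₂; _×_; _,_; proj₁; proj₂)
open import Data.Sum using (_⊎_; inj₁; inj₂)
open import Function using (_∘_)
open import Relation.Nullary using (Dec; yes; no; contradiction)
open import Relation.Nullary.Decidable using (_×-dec_)
open import Relation.Binary.PropositionalEquality
open import Relation.Binary.Construct.Closure.ReflexiveTransitive using (Star; ε; _◅_; _◅◅_)

-- Sums over Fin n

∑ : ∀ {n} → (Fin n → ℕ) → ℕ
∑ f = sum (tabulate f)

∑-cong : ∀ {n} {f g : Fin n → ℕ} → f ≗ g → ∑ f ≡ ∑ g
∑-cong {zero}  _ = refl
∑-cong {suc n} h = cong₂ _+_ (h Fin.zero) (∑-cong (h ∘ Fin.suc))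

∑-mono : ∀ {n} {f g : Fin n → ℕ} → (∀ x → f x ≤ g x) → ∑ f ≤ ∑ g
∑-mono {zero}  _ = z≤n
∑-mono {suc n} h = +-mono-≤ (h Fin.zero) (∑-mono (h ∘ Fin.suc))

∑-+ : ∀ {n} (f g : Fin n → ℕ) → ∑ (λ x → f x + g x) ≡ ∑ f + ∑ g
∑-+ {zero}  f g = refl
∑-+ {suc n} f g = trans (cong (f Fin.zero + g Fin.zero +_) (∑-+ (f ∘ Fin.suc) (g ∘ Fin.suc)))
  (interchange (f Fin.zero) (g Fin.zero) (∑ (f ∘ Fin.suc)) (∑ (g ∘ Fin.suc)))

∑-*ˡ : ∀ {n} k (f : Fin n → ℕ) → ∑ (λ x → k * f x) ≡ k * ∑ f
∑-*ˡ {zero}  k f = sym (*-zeroʳ k)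
∑-*ˡ {suc n} k f = trans (cong (k * f Fin.zero +_) (∑-*ˡ k (f ∘ Fin.suc))) (sym (*-distribˡ-+ k _ _))

∑-0 : ∀ n → ∑ {n} (λ _ → 0) ≡ 0
∑-0 zero    = refl
∑-0 (suc n) = ∑-0 n

∑-positive : ∀ {n} (f : Fin n → ℕ) → 1 ≤ ∑ f → ∃ λ x → 1 ≤ f x
∑-positive {suc n} f p with f Fin.zero in eq
... | suc _ = Fin.zero , subst (1 ≤_) (sym eq) (s≤s z≤n)
... | zero  = let x , q = ∑-positive (f ∘ Fin.suc) p in Fin.suc x , q

-- Recursion on both indices, rather than a test `x ≡ a`, lets sums against a pile compute, so that
-- `∑-pile-*` is a plain induction.
pile : ∀ {n} → Fin n → ℕ → Fin n → ℕ
pile Fin.zero    k Fin.zero    = k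
pile Fin.zero    k (Fin.suc x) = 0
pile (Fin.suc a) k Fin.zero    = 0
pile (Fin.suc a) k (Fin.suc x) = pile a k x

pile-self : ∀ {n} (a : Fin n) k → pile a k a ≡ k
pile-self Fin.zero    k = refl
pile-self (Fin.suc a) k = pile-self a k

pile-other : ∀ {n} {a x : Fin n} k → x ≢ a → pile a k x ≡ 0
pile-other {a = Fin.zero}  {Fin.zero}  k x≢a = contradiction refl x≢a
pile-other {a = Fin.zero}  {Fin.suc x} k x≢a = refl
pile-other {a = Fin.suc a} {Fin.zero}  k x≢a = refl
pile-other {a = Fin.suc a} {Fin.suc x} k x≢a = pile-other k (x≢a ∘ cong Fin.suc)

∑-pile-* : ∀ {n} (a : Fin n) k (f : Fin n → ℕ) → ∑ (λ x → pile a k x * f x) ≡ k * f a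
∑-pile-* {suc n} Fin.zero    k f = trans (cong (k * f Fin.zero +_) (∑-0 n)) (+-identityʳ _)
∑-pile-* {suc n} (Fin.suc a) k f = ∑-pile-* a k (f ∘ Fin.suc)

weight : ∀ {n} → (Fin n → ℕ) → (Fin n → ℕ) → ℕ
weight w D = ∑ (λ x → D x * w x)

∑-pile : ∀ {n} (a : Fin n) k → ∑ (pile a k) ≡ k
∑-pile a k = trans (∑-cong (λ x → sym (*-identityʳ (pile a k x))))
  (trans (∑-pile-* a k (λ _ → 1)) (*-identityʳ k))

∑-++ : ∀ m {n} (f : Fin (m + n) → ℕ) → ∑ f ≡ ∑ (f ∘ (Fin._↑ˡ n)) + ∑ (f ∘ (m Fin.↑ʳ_))
∑-++ zero    f = refl
∑-++ (suc m) f = trans (cong (f Fin.zero +_) (∑-++ m (f ∘ Fin.suc))) (sym (+-assoc (f Fin.zero) _ _))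

∑-combine : ∀ m {n} (f : Fin (m * n) → ℕ) → ∑ f ≡ ∑ (λ i → ∑ (λ j → f (Fin.combine {m} i j)))
∑-combine zero        f = refl
∑-combine (suc m) {n} f = trans (∑-++ n f) (cong (∑ (f ∘ (Fin._↑ˡ (m * n))) +_) (∑-combine m (f ∘ (n Fin.↑ʳ_))))

-- Putting `g a` on top of `f` at `a`, where `f` vanishes, stays below `g`. With charges as `f` and
-- powers of two as `g`, an uncharged vertex leaves its whole term of the stacking cost unspent.
∑-strict-at : ∀ {n} {f g : Fin n → ℕ} a → (∀ x → f x ≤ g x) → f a ≡ 0 → ∑ f + g a ≤ ∑ g
∑-strict-at {f = f} {g} a f≤g fa≡0 = begin
  ∑ f + g a                      ≡⟨ cong (∑ f +_) (∑-pile a (g a)) ⟨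
  ∑ f + ∑ (pile a (g a))         ≡⟨ ∑-+ f (pile a (g a)) ⟨
  ∑ (λ x → f x + pile a (g a) x) ≤⟨ ∑-mono pointwise ⟩
  ∑ g                            ∎
  where
  open ≤-Reasoning
  pointwise : ∀ x → f x + pile a (g a) x ≤ g x
  pointwise x with x Fin.≟ a
  ... | yes refl = ≤-reflexive (cong₂ _+_ fa≡0 (pile-self a (g a)))
  ... | no x≢a   = subst (_≤ g x) (sym (trans (cong (f x +_) (pile-other (g a) x≢a)) (+-identityʳ (f x)))) (f≤g x)

pile-+ : ∀ {n} (a : Fin n) k l x → pile a (k + l) x ≡ pile a k x + pile a l x
pile-+ Fin.zero    k l Fin.zero    = refl
pile-+ Fin.zero    k l (Fin.suc x) = refl
pile-+ (Fin.suc a) k l Fin.zero    = refl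
pile-+ (Fin.suc a) k l (Fin.suc x) = pile-+ a k l x

pile-0 : ∀ {n} (a : Fin n) x → pile a 0 x ≡ 0
pile-0 Fin.zero    Fin.zero    = refl
pile-0 Fin.zero    (Fin.suc x) = refl
pile-0 (Fin.suc a) Fin.zero    = refl
pile-0 (Fin.suc a) (Fin.suc x) = pile-0 a x

pile-≤ : ∀ {n} (a : Fin n) (f : Fin n → ℕ) x → pile a (f a) x ≤ f x
pile-≤ a f x with x Fin.≟ a
... | yes refl = ≤-reflexive (pile-self a (f a))
... | no x≢a   = ≤-trans (≤-reflexive (pile-other (f a) x≢a)) z≤n

clear : ∀ {n} → Fin n → (Fin n → ℕ) → Fin n → ℕ
clear a f x = f x ∸ pile a (f a) x

clear-+ : ∀ {n} (a : Fin n) f x → pile a (f a) x + clear a f x ≡ f x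
clear-+ a f x = m+[n∸m]≡n (pile-≤ a f x)

∑-clear : ∀ {n} (a : Fin n) f → f a + ∑ (clear a f) ≡ ∑ f
∑-clear a f = trans (cong (_+ ∑ (clear a f)) (sym (∑-pile a (f a))))
  (trans (sym (∑-+ (pile a (f a)) (clear a f))) (∑-cong (clear-+ a f)))

-- Metrics

infix 4 _⊢_~_
_⊢_~_ : (G : Graph) → Fin (size G) → Fin (size G) → Set
G ⊢ u ~ v = _~_ G u v

-- These axioms pin down the graph distance without mentioning walks: iterating `descent` gives a
-- walk of length `dist u v`, and `lipschitz` excludes shorter ones.
record Metric (G : Graph) : Set where
  field
    dist      : Fin (size G) → Fin (size G) → ℕ
    dist-refl : ∀ x → dist x x ≡ 0
    dist-eq   : ∀ {x y} → dist x y ≡ 0 → x ≡ y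
    lipschitz : ∀ v {u w} → G ⊢ u ~ w → dist v w ≤ suc (dist v u)
    descent   : ∀ {u v k} → dist u v ≡ suc k → ∃ λ w → (G ⊢ u ~ w) × dist w v ≡ k

  -- Along a geodesic from `y` to `z` each edge moves the distance from `x` up by at most one.
  triangle : ∀ x y z → dist x z ≤ dist x y + dist y z
  triangle x y z = go (dist y z) y refl
    where
    open ≤-Reasoning
    go : ∀ k y → dist y z ≡ k → dist x z ≤ dist x y + k
    go zero    y eq = ≤-reflexive (trans (cong (dist x) (sym (dist-eq eq))) (sym (+-identityʳ _)))
    go (suc k) y eq with descent eq
    ... | w , y~w , eq′ = begin
      dist x z          ≤⟨ go k w eq′ ⟩
      dist x w + k      ≤⟨ +-monoˡ-≤ k (lipschitz x y~w) ⟩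
      suc (dist x y) + k ≡⟨ +-suc (dist x y) k ⟨
      dist x y + suc k  ∎

  edge-dist : ∀ {u w} → G ⊢ u ~ w → dist u w ≤ 1
  edge-dist {u} {w} u~w = subst (λ z → dist u w ≤ suc z) (dist-refl u) (lipschitz u u~w)

  descent-≢ : ∀ {u v w k} → dist u v ≡ suc k → dist w v ≡ k → u ≢ w
  descent-≢ p q refl = 1+n≢n (trans (sym p) q)

  stackCost : Fin (size G) → ℕ
  stackCost v = ∑ (λ x → 2 ^ dist v x)

-- Pebbling

module _ {G : Graph} where

  private V = Fin (size G)

  step-≢ : ∀ {D D′ : Distribution G} ((u , v , _) : PebStep G D D′) → u ≢ v
  step-≢ {D} (u , .u , _ , _ , p , q , _) refl =
    <-irrefl (trans (sym p) q) (s≤s (m∸n≤m (D u) 2))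

  -- Additive on both sides, so that it can be summed and cancelled without truncated subtraction.
  step-balance : ∀ {D D′ : Distribution G} ((u , v , _) : PebStep G D D′) →
    ∀ x → D′ x + pile u 2 x ≡ D x + pile v 1 x
  step-balance {D} {D′} s@(u , v , _ , 2≤Du , p , q , r) x with x Fin.≟ u | x Fin.≟ v
  ... | yes refl | yes refl = contradiction refl (step-≢ {D} {D′} s)
  ... | yes refl | no x≢v rewrite pile-self u 2 | pile-other {a = v} 1 x≢v | p =
        trans (m∸n+n≡m 2≤Du) (sym (+-identityʳ _))
  ... | no x≢u | yes refl rewrite pile-self v 1 | pile-other {a = u} 2 x≢u | q =
        trans (+-identityʳ _) (+-comm 1 (D v))
  ... | no x≢u | no x≢v rewrite pile-other {a = u} 2 x≢u | pile-other {a = v} 1 x≢v = cong (_+ 0) (r x x≢u x≢v)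

  fire : V → V → Distribution G → Distribution G
  fire u v D x with x Fin.≟ u | x Fin.≟ v
  ... | yes _ | _     = D x ∸ 2
  ... | no _  | yes _ = suc (D x)
  ... | no _  | no _  = D x

  fire-step : ∀ {u v} D → G ⊢ u ~ v → u ≢ v → 2 ≤ D u → PebStep G D (fire u v D)
  fire-step {u} {v} D u~v u≢v 2≤Du = u , v , u~v , 2≤Du , at-u , at-v , at-w
    where
    at-u : fire u v D u ≡ D u ∸ 2
    at-u with u Fin.≟ u | u Fin.≟ v
    ... | yes _  | _ = refl
    ... | no u≢u | _ = contradiction refl u≢u
    at-v : fire u v D v ≡ suc (D v)
    at-v with v Fin.≟ u | v Fin.≟ v
    ... | yes v≡u | _      = contradiction (sym v≡u) u≢v
    ... | no _    | yes _  = refl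
    ... | no _    | no v≢v = contradiction refl v≢v
    at-w : ∀ w → w ≢ u → w ≢ v → fire u v D w ≡ D w
    at-w w w≢u w≢v with w Fin.≟ u | w Fin.≟ v
    ... | yes w≡u | _       = contradiction w≡u w≢u
    ... | no _    | yes w≡v = contradiction w≡v w≢v
    ... | no _    | no _    = refl

  infix 4 _⇝_
  -- Surplus pebbles may be forgotten. The pointwise bound also lets distributions with equal values
  -- replace one another without function extensionality.
  _⇝_ : Distribution G → Distribution G → Set
  D ⇝ E = ∃ λ E′ → Reachable G D E′ × (∀ x → E x ≤ E′ x)

  -- The same moves are replayed on `F`; each changes both sides of the inequality by the same
  -- amount, so domination persists.
  reachable-frame : ∀ {D E} → Reachable G D E → ∀ {r F : Distribution G} → (∀ x → D x + r x ≤ F x) →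
    F ⇝ (λ x → E x + r x)
  reachable-frame ε le = _ , ε , le
  reachable-frame {D} (_◅_ {j = D₁} s@(u , v , u~v , 2≤Du , _) ss) {r} {F} le =
    let E′ , reach , le″ = reachable-frame ss le′ in E′ , s′ ◅ reach , le″
    where
    open ≤-Reasoning
    u≢v : u ≢ v
    u≢v = step-≢ {D} {D₁} s
    s′ : PebStep G F (fire u v F)
    s′ = fire-step F u~v u≢v (≤-trans 2≤Du (≤-trans (m≤m+n (D u) (r u)) (le u)))
    le′ : ∀ x → D₁ x + r x ≤ fire u v F x
    le′ x = +-cancelʳ-≤ (pile u 2 x) _ _ (begin
      D₁ x + r x + pile u 2 x       ≡⟨ xy∙z≈xz∙y (D₁ x) (r x) (pile u 2 x) ⟩
      D₁ x + pile u 2 x + r x       ≡⟨ cong (_+ r x) (step-balance {D} {D₁} s x) ⟩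
      D x + pile v 1 x + r x        ≡⟨ xy∙z≈xz∙y (D x) (pile v 1 x) (r x) ⟩
      D x + r x + pile v 1 x        ≤⟨ +-monoˡ-≤ _ (le x) ⟩
      F x + pile v 1 x              ≡⟨ step-balance {F} {fire u v F} s′ x ⟨
      fire u v F x + pile u 2 x     ∎)

  ⇝-refl : ∀ {D E : Distribution G} → (∀ x → E x ≤ D x) → D ⇝ E
  ⇝-refl le = _ , ε , le

  ⇝-trans : ∀ {D E F : Distribution G} → D ⇝ E → E ⇝ F → D ⇝ F
  ⇝-trans {E = E} (E′ , D⟶E′ , E≤E′) (F′ , E⟶F′ , F≤F′) =
    let F″ , E′⟶F″ , F′≤F″ = reachable-frame E⟶F′ {λ _ → 0} (λ x → subst (_≤ E′ x) (sym (+-identityʳ (E x))) (E≤E′ x))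
    in F″ , D⟶E′ ◅◅ E′⟶F″ , λ x → ≤-trans (F≤F′ x) (≤-trans (m≤m+n (F′ x) 0) (F′≤F″ x))

  ⇝-frame : ∀ {D E : Distribution G} (r : Distribution G) → D ⇝ E → (λ x → D x + r x) ⇝ (λ x → E x + r x)
  ⇝-frame r (E′ , D⟶E′ , E≤E′) =
    let F , reach , le = reachable-frame D⟶E′ {r} (λ _ → ≤-refl)
    in F , reach , λ x → ≤-trans (+-monoˡ-≤ (r x) (E≤E′ x)) (le x)

  ⇝-+ : ∀ {D E D′ E′ : Distribution G} → D ⇝ E → D′ ⇝ E′ → (λ x → D x + D′ x) ⇝ (λ x → E x + E′ x)
  ⇝-+ {D} {E} {D′} {E′} p q = ⇝-trans (⇝-frame D′ p)
    (⇝-trans (⇝-refl (λ x → ≤-reflexive (+-comm (D′ x) (E x))))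
    (⇝-trans (⇝-frame E q) (⇝-refl (λ x → ≤-reflexive (+-comm (E x) (E′ x))))))

  ⇝-edge : ∀ {u v : V} → G ⊢ u ~ v → u ≢ v → (λ x → pile u 1 x + pile u 1 x) ⇝ pile v 1
  ⇝-edge {u} {v} u~v u≢v = fire u v D , s ◅ ε , le
    where
    D : Distribution G
    D x = pile u 1 x + pile u 1 x
    s : PebStep G D (fire u v D)
    s = fire-step D u~v u≢v (≤-reflexive (sym (cong₂ _+_ (pile-self u 1) (pile-self u 1))))
    le : ∀ x → pile v 1 x ≤ fire u v D x
    le x with x Fin.≟ u | x Fin.≟ v
    ... | yes refl | _        = ≤-trans (≤-reflexive (pile-other 1 u≢v)) z≤n
    ... | no _     | yes refl = ≤-trans (≤-reflexive (pile-self v 1)) (s≤s z≤n)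
    ... | no _     | no x≢v   = ≤-trans (≤-reflexive (pile-other 1 x≢v)) z≤n

  -- A step gives up weight `2 * w u` and gains `w v`; the lost weight is added to both sides so
  -- that `step-balance` can be summed.
  weight-step : ∀ {w : V → ℕ} → (∀ {u v} → G ⊢ u ~ v → w v ≤ 2 * w u) →
    ∀ {D D′} → PebStep G D D′ → weight w D′ ≤ weight w D
  weight-step {w} hw {D} {D′} s@(u , v , u~v , _) = +-cancelʳ-≤ (2 * w u) _ _ (begin
    weight w D′ + 2 * w u                       ≡⟨ expand D′ u 2 ⟨
    ∑ (λ x → (D′ x + pile u 2 x) * w x)         ≡⟨ ∑-cong (λ x → cong (_* w x) (step-balance {D} {D′} s x)) ⟩
    ∑ (λ x → (D x + pile v 1 x) * w x)          ≡⟨ expand D v 1 ⟩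
    weight w D + 1 * w v                        ≡⟨ cong (weight w D +_) (*-identityˡ (w v)) ⟩
    weight w D + w v                            ≤⟨ +-monoʳ-≤ (weight w D) (hw u~v) ⟩
    weight w D + 2 * w u                        ∎)
    where
    open ≤-Reasoning
    expand : ∀ (E : Distribution G) a k → ∑ (λ x → (E x + pile a k x) * w x) ≡ weight w E + k * w a
    expand E a k = trans (∑-cong (λ x → *-distribʳ-+ (w x) (E x) (pile a k x)))
      (trans (∑-+ (λ x → E x * w x) (λ x → pile a k x * w x)) (cong (weight w E +_) (∑-pile-* a k w)))

  weight-reachable : ∀ {w : V → ℕ} → (∀ {u v} → G ⊢ u ~ v → w v ≤ 2 * w u) →
    ∀ {D D′} → Reachable G D D′ → weight w D′ ≤ weight w D
  weight-reachable hw ε        = ≤-refl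
  weight-reachable hw (s ◅ ss) = ≤-trans (weight-reachable hw ss) (weight-step hw s)

-- All `N` pebbles are stacked on `v`, where the weight of a pebble is `2 ^ 0`; any covering
-- distribution weighs at least `stackCost v`.
stackCost-necessary : ∀ {G} (M : Metric G) v {N} → CoverSolvable G N → Metric.stackCost M v ≤ N
stackCost-necessary {G} M v {N} solv with solv (pile v N) (∑-pile v N)
... | D′ , reach , covered = begin
  stackCost v                      ≤⟨ ∑-mono (λ x → subst (_≤ D′ x * 2 ^ dist v x) (*-identityˡ _) (*-monoˡ-≤ (2 ^ dist v x) (covered x))) ⟩
  weight w D′                      ≤⟨ weight-reachable {w = w} (λ u~v → ^-monoʳ-≤ 2 (lipschitz v u~v)) reach ⟩
  weight w (pile v N)              ≡⟨ ∑-pile-* v N w ⟩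
  N * 2 ^ dist v v                 ≡⟨ cong (λ k → N * 2 ^ k) (dist-refl v) ⟩
  N * 1                            ≡⟨ *-identityʳ N ⟩
  N                                ∎
  where
  open Metric M
  open ≤-Reasoning
  w : Fin (size G) → ℕ
  w x = 2 ^ dist v x

-- The cover pebbling theorem

module Stacking {G : Graph} (M : Metric G) where

  open Metric M
  private V = Fin (size G)

  -- A unit at y of level j stands for one pebble at y, paid for by 2 ^ j pebbles which have not been moved yet.
  record Unit (j : ℕ) (y : V) : Set where
    constructor unit
    field
      purse  : Distribution G
      price  : ∑ purse ≡ 2 ^ j
      payoff : _⇝_ {G} purse (pile y 1)
  open Unit

  supply : ∀ {j y} → List (Unit j y) → Distribution G
  supply []       x = 0
  supply (u ∷ us) x = purse u x + supply us x

  supply-++ : ∀ {j y} (us vs : List (Unit j y)) x → supply (us ++ vs) x ≡ supply us x + supply vs x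
  supply-++ []       vs x = refl
  supply-++ (u ∷ us) vs x = trans (cong (purse u x +_) (supply-++ us vs x)) (sym (+-assoc (purse u x) _ _))

  pebbles : ∀ h → ℕ → List (Unit 0 h)
  pebbles h k = replicate k (unit (pile h 1) (∑-pile h 1) (⇝-refl (λ _ → ≤-refl)))

  supply-pebbles : ∀ h k x → supply (pebbles h k) x ≡ pile h k x
  supply-pebbles h zero    x = sym (pile-0 h x)
  supply-pebbles h (suc k) x = trans (cong (pile h 1 x +_) (supply-pebbles h k x)) (sym (pile-+ h 1 k x))

  -- Two units at `y` make one of the next level at `y′`. For an odd number of units the last purse
  -- is given up, and `r` records its size `2 ^ j`; otherwise `r` is 0.
  pairUp : ∀ {j y y′} → G ⊢ y ~ y′ → y ≢ y′ → (us : List (Unit j y)) →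
    ∃₂ λ (vs : List (Unit (suc j) y′)) r → r ≤ 2 ^ j × (∀ x → supply vs x ≤ supply us x) ×
      ∑ (supply us) ≤ r + ∑ (supply vs)
  pairUp y~y′ y≢y′ [] = [] , 0 , z≤n , (λ _ → ≤-refl) , ≤-refl
  pairUp {j} y~y′ y≢y′ (unit u ∑u _ ∷ []) = [] , 2 ^ j , ≤-refl , (λ _ → z≤n) ,
    ≤-reflexive (trans (∑-+ u (λ _ → 0)) (cong (_+ ∑ {size G} (λ _ → 0)) ∑u))
  pairUp {j} {y} {y′} y~y′ y≢y′ (unit u₁ ∑u₁ u₁⇝y ∷ unit u₂ ∑u₂ u₂⇝y ∷ us)
    with pairUp y~y′ y≢y′ us
  ... | vs , r , r≤ , vs≤us , us≤ = unit u₁₂ ∑u₁₂ (⇝-trans (⇝-+ u₁⇝y u₂⇝y) (⇝-edge y~y′ y≢y′)) ∷ vs , r , r≤ ,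
    (λ x → ≤-trans (+-monoʳ-≤ (u₁₂ x) (vs≤us x)) (≤-reflexive (+-assoc (u₁ x) (u₂ x) _))) ,
    (begin
      ∑ (λ x → u₁ x + (u₂ x + supply us x))  ≡⟨ ∑-cong (λ x → sym (+-assoc (u₁ x) (u₂ x) _)) ⟩
      ∑ (λ x → u₁₂ x + supply us x)          ≡⟨ ∑-+ u₁₂ (supply us) ⟩
      ∑ u₁₂ + ∑ (supply us)                  ≤⟨ +-monoʳ-≤ (∑ u₁₂) us≤ ⟩
      ∑ u₁₂ + (r + ∑ (supply vs))            ≡⟨ x∙yz≈y∙xz (∑ u₁₂) r (∑ (supply vs)) ⟩
      r + (∑ u₁₂ + ∑ (supply vs))            ≡⟨ cong (r +_) (∑-+ u₁₂ (supply vs)) ⟨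
      r + ∑ (λ x → u₁₂ x + supply vs x)      ∎)
    where
    open ≤-Reasoning
    u₁₂ : Distribution G
    u₁₂ x = u₁ x + u₂ x
    ∑u₁₂ : ∑ u₁₂ ≡ 2 ^ suc j
    ∑u₁₂ = trans (∑-+ u₁ u₂) (trans (cong₂ _+_ ∑u₁ ∑u₂) (cong (2 ^ j +_) (sym (+-identityʳ _))))

  -- Route t i j y: i more edges lead from y, at level j, to t; units are stored at the later vertices.
  data Route (t : V) : ℕ → ℕ → V → Set where
    arrive : ∀ {j} → Route t 0 j t
    via    : ∀ {i j y y′} → G ⊢ y ~ y′ → y ≢ y′ → List (Unit (suc j) y′) → Route t i (suc j) y′ →
             Route t (suc i) j y

  stored : ∀ {t i j y} → Route t i j y → Distribution G
  stored arrive         x = 0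
  stored (via _ _ us ρ) x = supply us x + stored ρ x

  route-dist : ∀ {t i j y} → Route t i j y → dist y t ≤ i
  route-dist {t} arrive = ≤-reflexive (dist-refl t)
  route-dist {t} (via {y = y} {y′} y~y′ _ _ ρ) =
    ≤-trans (triangle y y′ t) (+-mono-≤ (edge-dist y~y′) (route-dist ρ))

  -- A geodesic from `z` to `y` is put in front of `ρ`, with no units at the vertices before `y`.
  -- The condition `l + k ≡ j` keeps `y` at level `j`, so `us` can be stored there unchanged.
  extend : ∀ {t i j y} (us : List (Unit j y)) (ρ : Route t i j y) k l z → dist z y ≡ k → l + k ≡ j →
    ∃₂ λ (ws : List (Unit l z)) (σ : Route t (k + i) l z) →
      ∀ x → supply ws x + stored σ x ≡ supply us x + stored ρ x
  extend us ρ zero    l z zy≡0 l+0≡j with dist-eq zy≡0 | trans (sym (+-identityʳ l)) l+0≡j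
  ... | refl | refl = us , ρ , λ _ → refl
  extend us ρ (suc k) l z zy≡k l+k≡j =
    let z′ , z~z′ , z′y≡k = descent zy≡k
        ws , σ , eq = extend us ρ k (suc l) z′ z′y≡k (trans (sym (+-suc l k)) l+k≡j)
    in [] , via z~z′ (descent-≢ zy≡k z′y≡k) ws σ , eq

  module Phase (N : ℕ) (large : ∀ v → stackCost v ≤ N) (e₀ : V → ℕ) (Thin : V → Set)
    (t : V) (t-thin : Thin t) (d : ℕ) (far : ∀ g x → 1 ≤ e₀ g → Thin x → d ≤ dist g x) where

    Delivered : Set
    Delivered = ∃ λ u → ∑ u ≡ 2 ^ d × _⇝_ {G} u (pile t 1) × (∀ x → u x ≤ e₀ x)

    -- `others` speaks of `e`, not `e₀`: only vertices whose excess is still untouched restrict the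
    -- charges. Earlier heads are exempt, and the current one is controlled by `Climbing`.
    record Bounded (e val : V → ℕ) : Set where
      field
        shrunk   : ∑ e < ∑ e₀
        others   : ∀ h → 1 ≤ e h → ∀ x → val x ≤ 2 ^ dist h x
        thin-val : ∀ x → Thin x → val x ≡ 0

    -- The last two inequalities together force `∑ e` to be positive, so a fat vertex survives to
    -- bound the charges in the next round.
    Wasted : Set
    Wasted = ∃₂ λ e val → Bounded e val × (∀ x → e x ≤ e₀ x) × N ≤ ∑ val + ∑ e × ∑ val < N

    load : ∀ {i j y} → List (Unit j y) → Route t i j y → (V → ℕ) → V → ℕ
    load us ρ e x = supply us x + stored ρ x + e x

    ∑-load : ∀ {i j y} (us : List (Unit j y)) (ρ : Route t i j y) e →
      ∑ (load us ρ e) ≡ ∑ (supply us) + ∑ (stored ρ) + ∑ e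
    ∑-load us ρ e = trans (∑-+ (λ x → supply us x + stored ρ x) e) (cong (_+ ∑ e) (∑-+ (supply us) (stored ρ)))

    -- The head g has wasted less than 2 ^ j pebbles on the vertices of its route before y (deficit),
    -- and nothing on those from y onwards (ahead).
    record Climbing {i j y} (g : V) (us : List (Unit j y)) (ρ : Route t i j y) (e val : V → ℕ) : Set where
      field
        level     : j + i ≡ d
        head-dist : dist g y ≤ j
        head-fat  : 1 ≤ e₀ g
        stock     : ∀ x → load us ρ e x ≤ e₀ x
        budget    : N ≤ ∑ val + ∑ (load us ρ e)
        bounded   : Bounded e val
        ahead     : ∀ x → j ≤ dist g x → val x ≤ 2 ^ dist g x
        deficit   : ∑ val + 2 ^ d < stackCost g + 2 ^ j
      open Bounded bounded public

      -- From `y` the route reaches `t` in `i` edges, so a fat vertex closer than `j` to `y` would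
      -- be closer than `j + i`, that is `d`, to the empty vertex `t`.
      level≤dist : ∀ {h} → 1 ≤ e₀ h → j ≤ dist h y
      level≤dist {h} fat = +-cancelʳ-≤ i j (dist h y) (begin
        j + i                ≡⟨ level ⟩
        d                    ≤⟨ far h t fat t-thin ⟩
        dist h t             ≤⟨ triangle h y t ⟩
        dist h y + dist y t  ≤⟨ +-monoʳ-≤ (dist h y) (route-dist ρ) ⟩
        dist h y + i         ∎)
        where open ≤-Reasoning

      e≤e₀ : ∀ x → e x ≤ e₀ x
      e≤e₀ x = ≤-trans (m≤n+m (e x) _) (stock x)

    -- The vertex h becomes the new head: a geodesic from h to y is put in front of ρ, with the excess of h at its start.
    start : ∀ {i j y} (us : List (Unit j y)) (ρ : Route t i j y) {e val} h →
      j + i ≡ d → dist h y ≡ j → 1 ≤ e h → (∀ x → load us ρ e x ≤ e₀ x) → N ≤ ∑ val + ∑ (load us ρ e) →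
      ∑ e ≤ ∑ e₀ → (∀ h → 1 ≤ e h → ∀ x → val x ≤ 2 ^ dist h x) → (∀ x → Thin x → val x ≡ 0) →
      ∃₂ λ (us′ : List (Unit 0 h)) (ρ′ : Route t (j + i) 0 h) → Climbing h us′ ρ′ (clear h e) val
    start {i} {j} {y} us ρ {e} {val} h level hy≡j fat stock budget e≤ others thin-val
      with extend us ρ j 0 h hy≡j refl
    ... | ws , σ , eq = us′ , σ , record
      { level = level
      ; head-dist = ≤-reflexive (dist-refl h)
      ; head-fat = fat₀
      ; stock = λ x → subst (_≤ e₀ x) (sym (same-load x)) (stock x)
      ; budget = subst (λ s → N ≤ ∑ val + s) (sym (∑-cong same-load)) budget
      ; bounded = record
        { shrunk = ≤-trans (≤-trans (+-monoˡ-≤ _ fat) (≤-reflexive (∑-clear h e))) e≤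
        ; others = λ g fat′ → others g (≤-trans fat′ (m∸n≤m (e g) (pile h (e h) g)))
        ; thin-val = thin-val }
      ; ahead = λ x _ → others h fat x
      -- As `t` is uncharged, its term `2 ^ dist h t`, at least `2 ^ d`, is unspent in
      -- `stackCost h`. The slack allowed at level 0 is `2 ^ 0`, which turns this bound into a
      -- strict one.
      ; deficit = ≤-trans (s≤s (≤-trans (+-monoʳ-≤ (∑ val) (^-monoʳ-≤ 2 (far h t fat₀ t-thin)))
                    (∑-strict-at t (others h fat) (thin-val t t-thin)))) (≤-reflexive (+-comm 1 (stackCost h)))
      }
      where
      open ≡-Reasoning
      fat₀ : 1 ≤ e₀ h
      fat₀ = ≤-trans fat (≤-trans (m≤n+m (e h) _) (stock h))
      us′ : List (Unit 0 h)
      us′ = pebbles h (e h) ++ ws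
      regroup : ∀ a b c f → a + b + c + f ≡ (b + c) + (a + f)
      regroup = solve-∀
      same-load : ∀ x → load us′ σ (clear h e) x ≡ load us ρ e x
      same-load x = begin
        supply us′ x + stored σ x + clear h e x
          ≡⟨ cong (λ s → s + stored σ x + clear h e x) (supply-++ (pebbles h (e h)) ws x) ⟩
        supply (pebbles h (e h)) x + supply ws x + stored σ x + clear h e x
          ≡⟨ regroup _ (supply ws x) (stored σ x) (clear h e x) ⟩
        (supply ws x + stored σ x) + (supply (pebbles h (e h)) x + clear h e x)
          ≡⟨ cong₂ _+_ (eq x) (trans (cong (_+ clear h e x) (supply-pebbles h (e h) x)) (clear-+ h e x)) ⟩
        supply us x + stored ρ x + e x ∎

    -- If no other fat vertex is within j of y, then 2 ^ j more pebbles can be charged to y: the sum 2 ^ j + 2 ^ j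
    -- is still at most 2 ^ dist h y for every remaining fat vertex h.
    advance : ∀ {i j y y′ g} {y~y′ : G ⊢ y ~ y′} {y≢y′ : y ≢ y′} {us ws} {ρ : Route t i (suc j) y′} {e val} →
      Climbing g us (via y~y′ y≢y′ ws ρ) e val → (∀ h → 1 ≤ e h → j < dist h y) →
      ∃₂ λ us′ val′ → Climbing g us′ ρ e val′
    advance {i} {j} {y} {y′} {g} {y~y′} {y≢y′} {us} {ws} {ρ} {e} {val} S alone with pairUp y~y′ y≢y′ us
    ... | vs , r , r≤2^j , vs≤us , us≤vs = us′ , val′ , record
      { level = trans (sym (+-suc j i)) level
      ; head-dist = ≤-trans (lipschitz g y~y′) (s≤s head-dist)
      ; head-fat = head-fat
      ; stock = λ x → ≤-trans (+-monoˡ-≤ (e x) (load≤ x)) (stock x)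
      ; budget = ≤-trans budget (begin
          ∑ val + ∑ (load us (via y~y′ y≢y′ ws ρ) e)      ≡⟨ cong (∑ val +_) (∑-load us (via y~y′ y≢y′ ws ρ) e) ⟩
          ∑ val + (∑ (supply us) + ∑ (stored (via y~y′ y≢y′ ws ρ)) + ∑ e)
            ≡⟨ cong (λ s → ∑ val + (∑ (supply us) + s + ∑ e)) (∑-+ (supply ws) (stored ρ)) ⟩
          ∑ val + (∑ (supply us) + (∑ (supply ws) + ∑ (stored ρ)) + ∑ e)
            ≤⟨ +-monoʳ-≤ (∑ val) (+-monoˡ-≤ (∑ e) (+-monoˡ-≤ _ us≤vs)) ⟩
          ∑ val + ((r + ∑ (supply vs)) + (∑ (supply ws) + ∑ (stored ρ)) + ∑ e)
            ≡⟨ regroup (∑ val) r (∑ (supply vs)) (∑ (supply ws)) (∑ (stored ρ)) (∑ e) ⟩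
          (∑ val + r) + ((∑ (supply vs) + ∑ (supply ws)) + ∑ (stored ρ) + ∑ e)
            ≡⟨ cong (λ s → (∑ val + r) + (s + ∑ (stored ρ) + ∑ e))
                 (trans (sym (∑-+ (supply vs) (supply ws))) (∑-cong (λ x → sym (supply-++ vs ws x)))) ⟩
          (∑ val + r) + (∑ (supply us′) + ∑ (stored ρ) + ∑ e)
            ≡⟨ cong₂ _+_ (sym ∑-val′) (sym (∑-load us′ ρ e)) ⟩
          ∑ val′ + ∑ (load us′ ρ e) ∎)
      ; bounded = record
        { shrunk = shrunk
        ; others = others′
        ; thin-val = λ x x-thin → trans (cong₂ _+_ (thin-val x x-thin) (pile-other r (thin≢y x-thin))) refl }
      ; ahead = λ x j<dist → subst (_≤ 2 ^ dist g x)
          (sym (trans (cong (val x +_) (pile-other {a = y} {x} r (λ { refl → <-irrefl refl (≤-trans j<dist head-dist) }))) (+-identityʳ (val x))))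
          (ahead x (<⇒≤ j<dist))
      ; deficit = begin-strict
          ∑ val′ + 2 ^ d                     ≡⟨ cong (_+ 2 ^ d) ∑-val′ ⟩
          ∑ val + r + 2 ^ d                  ≡⟨ xy∙z≈xz∙y (∑ val) r (2 ^ d) ⟩
          ∑ val + 2 ^ d + r                  <⟨ +-mono-<-≤ deficit r≤2^j ⟩
          stackCost g + 2 ^ j + 2 ^ j        ≡⟨ double (stackCost g) (2 ^ j) ⟩
          stackCost g + 2 ^ suc j            ∎
      }
      where
      open Climbing S
      open ≤-Reasoning
      us′ : List (Unit (suc j) y′)
      us′ = vs ++ ws
      val′ : V → ℕ
      val′ x = val x + pile y r x
      ∑-val′ : ∑ val′ ≡ ∑ val + r
      ∑-val′ = trans (∑-+ val (pile y r)) (cong (∑ val +_) (∑-pile y r))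
      regroup : ∀ a r b c f k → a + ((r + b) + (c + f) + k) ≡ (a + r) + ((b + c) + f + k)
      regroup = solve-∀
      double : ∀ a b → a + b + b ≡ a + 2 * b
      double = solve-∀
      load≤ : ∀ x → supply us′ x + stored ρ x ≤ supply us x + (supply ws x + stored ρ x)
      load≤ x = begin
        supply us′ x + stored ρ x                  ≡⟨ cong (_+ stored ρ x) (supply-++ vs ws x) ⟩
        supply vs x + supply ws x + stored ρ x     ≡⟨ +-assoc (supply vs x) _ _ ⟩
        supply vs x + (supply ws x + stored ρ x)   ≤⟨ +-monoˡ-≤ _ (vs≤us x) ⟩
        supply us x + (supply ws x + stored ρ x)   ∎
      j<d : j < d
      j<d = subst (j <_) level (m<m+n j (s≤s z≤n))
      -- Empty vertices are at distance at least `d` from the head, while `y` is within `j < d` of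
      -- it; so no waste is charged to an empty vertex.
      thin≢y : ∀ {x} → Thin x → x ≢ y
      thin≢y {x} x-thin refl = <-irrefl refl (≤-trans j<d (≤-trans (far g x head-fat x-thin) head-dist))
      -- The head is at distance exactly `j` from `y`, so `ahead` still covers `y` itself.
      val-y : val y ≤ 2 ^ j
      val-y = ≤-trans (ahead y (level≤dist head-fat)) (^-monoʳ-≤ 2 head-dist)
      others′ : ∀ h → 1 ≤ e h → ∀ x → val′ x ≤ 2 ^ dist h x
      others′ h fat x with x Fin.≟ y
      ... | no x≢y = subst (_≤ 2 ^ dist h x)
              (sym (trans (cong (val x +_) (pile-other r x≢y)) (+-identityʳ (val x)))) (others h fat x)
      ... | yes refl = begin
        val y + pile y r y    ≡⟨ cong (val y +_) (pile-self y r) ⟩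
        val y + r             ≤⟨ +-mono-≤ val-y r≤2^j ⟩
        2 ^ j + 2 ^ j         ≡⟨ cong (2 ^ j +_) (sym (+-identityʳ _)) ⟩
        2 ^ suc j             ≤⟨ ^-monoʳ-≤ 2 (alone h fat) ⟩
        2 ^ dist h y          ∎

    -- Termination is lexicographic: a change of head may lengthen the route but lowers `∑ e`, which
    -- `k` bounds; an advance keeps `k` and shortens the route.
    climb : ∀ k {i j y} g (us : List (Unit j y)) (ρ : Route t i j y) {e val} →
      Climbing g us ρ e val → ∑ e < k → Delivered ⊎ Wasted
    climb k g (unit u ∑u u⇝t ∷ us) (arrive {j}) {e} S _ = inj₁
      (u , trans ∑u (cong (2 ^_) (trans (sym (+-identityʳ j)) level)) , u⇝t ,
        λ x → ≤-trans (≤-trans (m≤m+n (u x) _) (≤-trans (m≤m+n (u x + supply us x) 0) (m≤m+n _ (e x)))) (stock x))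
      where open Climbing S
    -- Here `j` equals `d`, so the powers in `deficit` cancel and leave `∑ val < stackCost g`.
    climb k g [] (arrive {j}) {e} {val} S _ = inj₂
      (e , val , bounded , e≤e₀ , budget ,
        ≤-trans (+-cancelʳ-≤ (2 ^ d) _ _ (subst (λ l → ∑ val + 2 ^ d < stackCost g + 2 ^ l) j≡d deficit)) (large g))
      where
      open Climbing S
      j≡d : j ≡ d
      j≡d = trans (sym (+-identityʳ j)) level
    climb k {j = j} {y} g us (via _ _ _ _) {e} S ∑e<k
      with any? (λ h → (1 ≤? e h) ×-dec (dist h y ≤? j))
    climb (suc k) g us ρ {e} S ∑e<k | yes (h , fat , near) =
      -- `near` and `level≤dist` make `dist h y` exactly `j`, so units coming from `h` reach `y` at
      -- the level of those stored there.
      let us′ , ρ′ , S′ = start us ρ h level (≤-antisym near (level≤dist (≤-trans fat (e≤e₀ h)))) fat stock budget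
                            (<⇒≤ shrunk) others thin-val
      in climb k h us′ ρ′ S′ (≤-trans (≤-trans (+-monoˡ-≤ _ fat) (≤-reflexive (∑-clear h e))) (s≤s⁻¹ ∑e<k))
      where open Climbing S
    climb k g us (via _ _ _ ρ) S ∑e<k | no alone =
      let us′ , val′ , S′ = advance S (λ h fat → ≰⇒> (λ near → alone (h , fat , near)))
      in climb k g us′ ρ S′ ∑e<k

  -- As long as some closer pair exists, switch to it; the distance, bounded by `k`, falls each
  -- time.
  closest : ∀ (e : V → ℕ) {Thin : V → Set} → (∀ x → Dec (Thin x)) → ∀ k f t → 1 ≤ e f → Thin t → dist f t ≤ k →
    ∃₂ λ f t → 1 ≤ e f × Thin t × (∀ g x → 1 ≤ e g → Thin x → dist f t ≤ dist g x)
  closest e Thin? k f t fat thin ft≤k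
    with any? (λ g → any? (λ x → (1 ≤? e g) ×-dec Thin? x ×-dec (dist g x <? dist f t)))
  closest e Thin? k f t fat thin ft≤k | no none =
    f , t , fat , thin , λ g x fat′ thin′ → ≮⇒≥ (λ lt → none (g , x , fat′ , thin′ , lt))
  closest e Thin? zero f t fat thin ft≤k | yes (g , x , fat′ , thin′ , lt) =
    contradiction (≤-trans lt ft≤k) λ ()
  closest e Thin? (suc k) f t fat thin ft≤k | yes (g , x , fat′ , thin′ , lt) =
    closest e Thin? k g x fat′ thin′ (s≤s⁻¹ (≤-trans lt ft≤k))

  -- Covering the empty vertices one after another.

  module _ (N : ℕ) (large : ∀ v → stackCost v ≤ N) (D₀ : Distribution G) where

    -- The goal c is already paid for, leaving the excess e; val x is the number of pebbles spent on x so far.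
    -- As val x ≤ 2 ^ dist root x, an empty vertex would give ∑ val < stackCost root if there were no excess.
    record State (c e val : V → ℕ) : Set where
      field
        reach    : _⇝_ {G} D₀ (λ x → c x + e x)
        budget   : N ≤ ∑ val + ∑ e
        others   : ∀ h → 1 ≤ e h → ∀ x → val x ≤ 2 ^ dist h x
        thin-val : ∀ x → c x ≡ 0 → val x ≡ 0
        root     : V
        root-val : ∀ x → val x ≤ 2 ^ dist root x

    excess : ∀ {c e val} → State c e val → ∀ {t} → c t ≡ 0 → ∃ λ f → 1 ≤ e f
    excess {c} {e} {val} S {t} ct≡0 = ∑-positive e (≤-trans (m^n>0 2 (dist root t)) (+-cancelˡ-≤ (∑ val) _ _ (begin
      ∑ val + 2 ^ dist root t  ≤⟨ ∑-strict-at t root-val (thin-val t ct≡0) ⟩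
      stackCost root           ≤⟨ large root ⟩
      N                        ≤⟨ budget ⟩
      ∑ val + ∑ e              ∎)))
      where
      open State S
      open ≤-Reasoning

    -- The charge at `t` rises from 0 to `2 ^ dist f t`, which every fat vertex tolerates because
    -- none is closer to `t` than `f`.
    deliver : ∀ {c e val} → State c e val → ∀ {f t} u → 1 ≤ e f → c t ≡ 0 →
      (∀ h → 1 ≤ e h → dist f t ≤ dist h t) → ∑ u ≡ 2 ^ dist f t → _⇝_ {G} u (pile t 1) → (∀ x → u x ≤ e x) →
      ∃₂ λ c′ val′ → State c′ (λ x → e x ∸ u x) val′
    deliver {c} {e} {val} S {f} {t} u fat ct≡0 near ∑u u⇝t u≤e = c′ , val′ , record
      { reach = ⇝-trans reach (⇝-trans (⇝-refl (λ x → ≤-reflexive (split x)))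
          (⇝-trans (⇝-frame (λ x → c x + e′ x) u⇝t) (⇝-refl (λ x → ≤-reflexive (xy∙z≈y∙xz (c x) (pile t 1 x) (e′ x))))))
      ; budget = ≤-trans budget (≤-reflexive (begin
          ∑ val + ∑ e                       ≡⟨ cong (∑ val +_) ∑e ⟩
          ∑ val + (2 ^ d + ∑ e′)            ≡⟨ +-assoc (∑ val) _ _ ⟨
          ∑ val + 2 ^ d + ∑ e′              ≡⟨ cong (λ s → ∑ val + s + ∑ e′) (∑-pile t (2 ^ d)) ⟨
          ∑ val + ∑ (pile t (2 ^ d)) + ∑ e′ ≡⟨ cong (_+ ∑ e′) (∑-+ val (pile t (2 ^ d))) ⟨
          ∑ val′ + ∑ e′                     ∎))
      ; others = λ h fat′ → val′-≤ h (≤-trans fat′ (m∸n≤m (e h) (u h)))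
      ; thin-val = thin-val′
      -- `f` may lose its excess in the payment; having been fat before is enough for the bound on
      -- `val′`.
      ; root = f
      ; root-val = val′-≤ f fat
      }
      where
      open State S
      open ≡-Reasoning
      d = dist f t
      e′ c′ val′ : V → ℕ
      e′ x = e x ∸ u x
      c′ x = c x + pile t 1 x
      val′ x = val x + pile t (2 ^ d) x
      ∑e : ∑ e ≡ 2 ^ d + ∑ e′
      ∑e = trans (∑-cong (λ x → sym (m+[n∸m]≡n (u≤e x)))) (trans (∑-+ u e′) (cong (_+ ∑ e′) ∑u))
      split : ∀ x → u x + (c x + e′ x) ≡ c x + e x
      split x = trans (sym (xy∙z≈y∙xz (c x) (u x) (e′ x))) (trans (+-assoc (c x) (u x) _) (cong (c x +_) (m+[n∸m]≡n (u≤e x))))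
      val′-≤ : ∀ h → 1 ≤ e h → ∀ x → val′ x ≤ 2 ^ dist h x
      val′-≤ h fat′ x with x Fin.≟ t
      ... | yes refl = ≤-trans (≤-reflexive (cong₂ _+_ (thin-val t ct≡0) (pile-self t (2 ^ d)))) (^-monoʳ-≤ 2 (near h fat′))
      ... | no x≢t   = ≤-trans (≤-reflexive (trans (cong (val x +_) (pile-other (2 ^ d) x≢t)) (+-identityʳ (val x)))) (others h fat′ x)
      thin-val′ : ∀ x → c′ x ≡ 0 → val′ x ≡ 0
      thin-val′ x c′x≡0 = cong₂ _+_ (thin-val x (m+n≡0⇒m≡0 (c x) c′x≡0)) (pile-other (2 ^ d) x≢t)
        where
        x≢t : x ≢ t
        x≢t refl with trans (sym (pile-self t 1)) (m+n≡0⇒n≡0 (c t) c′x≡0)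
        ... | ()

    -- Every round lowers `∑ e`, whether a pebble is delivered or excess is wasted, so `k` serves as
    -- fuel.
    solve : ∀ k {c e val} → State c e val → ∑ e < k → ∃ λ D → Reachable G D₀ D × Covered G D
    solve k {c} {e} S ∑e<k with any? (λ x → c x ≟ 0)
    solve k {c} {e} S ∑e<k | no full = let D , reachable , c+e≤D = State.reach S in
      D , reachable , λ x → ≤-trans (n≢0⇒n>0 (λ cx≡0 → full (x , cx≡0))) (≤-trans (m≤m+n (c x) (e x)) (c+e≤D x))
    solve (suc k) {c} {e} {val} S ∑e<k | yes (t₀ , thin₀)
      with excess S thin₀
    ... | f₀ , fat₀ with closest e (λ x → c x ≟ 0) _ f₀ t₀ fat₀ thin₀ ≤-refl
    ... | f , t , fat , thin , far = finish (climb _ f us ρ S₀ ≤-refl)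
      where
      open State S
      open Phase N large e (λ x → c x ≡ 0) t thin (dist f t) far
      -- From no units and the route of length 0 at level `dist f t`, `start` produces a geodesic
      -- from `f` to `t`.
      started = start [] (arrive {j = dist f t}) f (+-identityʳ _) refl fat (λ _ → ≤-refl) budget ≤-refl others thin-val
      us = proj₁ started
      ρ  = proj₁ (proj₂ started)
      S₀ = proj₂ (proj₂ started)
      finish : Delivered ⊎ Wasted → ∃ λ D → Reachable G D₀ D × Covered G D
      finish (inj₁ (u , ∑u , u⇝t , u≤e)) =
        let _ , _ , S′ = deliver S u fat thin (λ h fat′ → far h t fat′ thin) ∑u u⇝t u≤e
        in solve k S′ (≤-trans (begin-strict
             ∑ (λ x → e x ∸ u x)        <⟨ m<n+m _ (subst (0 <_) (sym ∑u) (m^n>0 2 (dist f t))) ⟩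
             ∑ u + ∑ (λ x → e x ∸ u x)  ≡⟨ ∑-+ u (λ x → e x ∸ u x) ⟨
             ∑ (λ x → u x + (e x ∸ u x)) ≡⟨ ∑-cong (λ x → m+[n∸m]≡n (u≤e x)) ⟩
             ∑ e                        ∎) (s≤s⁻¹ ∑e<k))
        where open ≤-Reasoning
      finish (inj₂ (e′ , val′ , bounded , e′≤e , budget′ , ∑val′<N)) =
        let h , fat′ = ∑-positive e′ (+-cancelˡ-< (∑ val′) 0 (∑ e′)
                         (subst (_< ∑ val′ + ∑ e′) (sym (+-identityʳ _)) (≤-trans ∑val′<N budget′)))
        in solve k {c} {e′} {val′} (record
             { reach = ⇝-trans reach (⇝-refl (λ x → +-monoʳ-≤ (c x) (e′≤e x)))
             ; budget = budget′
             ; others = Bounded.others bounded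
             ; thin-val = Bounded.thin-val bounded
             ; root = h
             ; root-val = Bounded.others bounded h fat′ })
           (≤-trans (Bounded.shrunk bounded) (s≤s⁻¹ ∑e<k))

  stackCost-sufficient : ∀ {N} → V → (∀ v → stackCost v ≤ N) → CoverSolvable G N
  stackCost-sufficient {N} v large D ∑D≡N = solve N large D _ S ≤-refl
    where
    min+monus : ∀ n → n ⊓ 1 + (n ∸ 1) ≡ n
    min+monus zero    = refl
    min+monus (suc n) = cong (λ k → suc (k + n)) (⊓-zeroʳ n)
    -- One pebble of each occupied vertex goes into the goal at charge 1; such charges are within
    -- bounds for any root.
    S : State N large D (λ x → D x ⊓ 1) (λ x → D x ∸ 1) (λ x → D x ⊓ 1)
    S = record
      { reach = ⇝-refl (λ x → ≤-reflexive (min+monus (D x)))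
      ; budget = ≤-reflexive (trans (sym ∑D≡N) (trans (∑-cong (λ x → sym (min+monus (D x)))) (∑-+ (λ x → D x ⊓ 1) (λ x → D x ∸ 1))))
      ; others = λ h _ x → ≤-trans (m⊓n≤n (D x) 1) (m^n>0 2 (dist h x))
      ; thin-val = λ _ eq → eq
      ; root = v
      ; root-val = λ x → ≤-trans (m⊓n≤n (D x) 1) (m^n>0 2 (dist v x))
      }

-- From maximal stacking costs to cover pebbling numbers.

record MaxStackCost (G : Graph) (k : ℕ) : Set where
  field
    metric : Metric G
  open Metric metric public
  field
    bound    : ∀ v → stackCost v ≤ k
    attained : ∃ λ v → stackCost v ≡ k

coverPebblingTheorem : ∀ {G k} → MaxStackCost G k → IsCoverPebblingNumber G k
coverPebblingTheorem {G} {k} S = Stacking.stackCost-sufficient metric (proj₁ attained) bound ,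
  λ N N<k solv → <-irrefl refl (≤-trans N<k
    (subst (_≤ N) (proj₂ attained) (stackCost-necessary metric (proj₁ attained) solv)))
  where open MaxStackCost S

coverPebblingNumber-unique : ∀ {G k l} → IsCoverPebblingNumber G k → IsCoverPebblingNumber G l → k ≡ l
coverPebblingNumber-unique (solvₖ , minₖ) (solvₗ , minₗ) =
  ≤-antisym (≮⇒≥ (λ l<k → minₖ _ l<k solvₗ)) (≮⇒≥ (λ k<l → minₗ _ k<l solvₖ))

argmax : ∀ {n} (f : Fin (suc n) → ℕ) → ∃ λ v → ∀ x → f x ≤ f v
argmax {zero}  f = Fin.zero , λ { Fin.zero → ≤-refl }
argmax {suc n} f with argmax (f ∘ Fin.suc)
... | v , max with ≤-total (f Fin.zero) (f (Fin.suc v))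
... | inj₁ f0≤fv = Fin.suc v , λ { Fin.zero → f0≤fv ; (Fin.suc x) → max x }
... | inj₂ fv≤f0 = Fin.zero , λ { Fin.zero → ≤-refl ; (Fin.suc x) → ≤-trans (max x) fv≤f0 }

-- The maximal stacking cost is itself a cover pebbling number, hence equals `c` by uniqueness. This
-- turns a factor known only through its cover pebbling number into input for `□-maxStackCost`.
coverPebblingTheorem⁻¹ : ∀ {G c} → Metric G → 1 ≤ size G → IsCoverPebblingNumber G c → MaxStackCost G c
coverPebblingTheorem⁻¹ {G@record { size = suc n }} M _ γ
  with argmax (Metric.stackCost M)
... | v , max = subst (MaxStackCost G) (coverPebblingNumber-unique (coverPebblingTheorem S) γ) S
  where
  S : MaxStackCost G (Metric.stackCost M v)
  S = record { metric = M ; bound = max ; attained = v , refl }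

-- Cartesian products

module _ {G H : Graph} where

  private
    fst : Fin (size (G □ H)) → Fin (size G)
    fst x = proj₁ (Fin.remQuot {size G} (size H) x)
    snd : Fin (size (G □ H)) → Fin (size H)
    snd x = proj₂ (Fin.remQuot {size G} (size H) x)
    pair : Fin (size G) → Fin (size H) → Fin (size (G □ H))
    pair = Fin.combine

    fst-pair : ∀ a b → fst (pair a b) ≡ a
    fst-pair a b = cong proj₁ (Finₚ.remQuot-combine {size G} a b)
    snd-pair : ∀ a b → snd (pair a b) ≡ b
    snd-pair a b = cong proj₂ (Finₚ.remQuot-combine {size G} a b)

  -- Distances add because each edge moves one coordinate only; `descent` first brings the `G`
  -- coordinate to its target, then the `H` coordinate.
  □-metric : Metric G → Metric H → Metric (G □ H)
  □-metric MG MH = record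
    { dist = δ
    ; dist-refl = λ x → cong₂ _+_ (MG.dist-refl (fst x)) (MH.dist-refl (snd x))
    ; dist-eq = λ {x} {y} eq → begin
        x                     ≡⟨ Finₚ.combine-remQuot {size G} (size H) x ⟨
        pair (fst x) (snd x)  ≡⟨ cong₂ pair (MG.dist-eq (m+n≡0⇒m≡0 _ eq)) (MH.dist-eq (m+n≡0⇒n≡0 (MG.dist (fst x) (fst y)) eq)) ⟩
        pair (fst y) (snd y)  ≡⟨ Finₚ.combine-remQuot {size G} (size H) y ⟩
        y                     ∎
    ; lipschitz = lip
    ; descent = desc
    }
    where
    open ≡-Reasoning
    module MG = Metric MG
    module MH = Metric MH
    δ : Fin (size (G □ H)) → Fin (size (G □ H)) → ℕ
    δ x y = MG.dist (fst x) (fst y) + MH.dist (snd x) (snd y)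
    lip : ∀ v {u w} → (G □ H) ⊢ u ~ w → δ v w ≤ suc (δ v u)
    lip v {u} {w} (inj₁ (eq , e)) rewrite eq =
      ≤-trans (+-monoʳ-≤ (MG.dist (fst v) (fst w)) (MH.lipschitz (snd v) e)) (≤-reflexive (+-suc (MG.dist (fst v) (fst w)) _))
    lip v {u} {w} (inj₂ (eq , e)) rewrite eq = +-monoˡ-≤ _ (MG.lipschitz (fst v) e)
    desc : ∀ {u v k} → δ u v ≡ suc k → ∃ λ w → ((G □ H) ⊢ u ~ w) × δ w v ≡ k
    desc {u} {v} eq with MG.dist (fst u) (fst v) in eqG
    ... | suc d with MG.descent eqG
    ...   | a , e , eq′ = pair a (snd u) , inj₂ (sym (snd-pair a (snd u)) , subst (G ⊢ fst u ~_) (sym (fst-pair a (snd u))) e) ,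
            trans (cong₂ _+_ (trans (cong (λ z → MG.dist z (fst v)) (fst-pair a (snd u))) eq′)
                             (cong (λ z → MH.dist z (snd v)) (snd-pair a (snd u)))) (suc-injective eq)
    desc {u} {v} eq | zero with MH.descent eq
    ...   | b , e , eq′ = pair (fst u) b , inj₁ (sym (fst-pair (fst u) b) , subst (H ⊢ snd u ~_) (sym (snd-pair (fst u) b)) e) ,
            cong₂ _+_ (trans (cong (λ z → MG.dist z (fst v)) (fst-pair (fst u) b)) eqG)
                      (trans (cong (λ z → MH.dist z (snd v)) (snd-pair (fst u) b)) eq′)

  □-stackCost : (MG : Metric G) (MH : Metric H) → ∀ v →
    Metric.stackCost (□-metric MG MH) v ≡ Metric.stackCost MG (fst v) * Metric.stackCost MH (snd v)
  □-stackCost MG MH v = begin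
    ∑ (λ x → 2 ^ (MG.dist (fst v) (fst x) + MH.dist (snd v) (snd x)))
      ≡⟨ ∑-combine (size G) _ ⟩
    ∑ (λ a → ∑ (λ b → 2 ^ (MG.dist (fst v) (fst (pair a b)) + MH.dist (snd v) (snd (pair a b)))))
      ≡⟨ ∑-cong (λ a → ∑-cong (λ b → trans
           (cong₂ (λ a′ b′ → 2 ^ (MG.dist (fst v) a′ + MH.dist (snd v) b′)) (fst-pair a b) (snd-pair a b))
           (^-distribˡ-+-* 2 (MG.dist (fst v) a) (MH.dist (snd v) b)))) ⟩
    ∑ (λ a → ∑ (λ b → 2 ^ MG.dist (fst v) a * 2 ^ MH.dist (snd v) b))
      ≡⟨ ∑-cong (λ a → trans (∑-*ˡ (2 ^ MG.dist (fst v) a) (λ b → 2 ^ MH.dist (snd v) b)) (*-comm (2 ^ MG.dist (fst v) a) _)) ⟩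
    ∑ (λ a → MH.stackCost (snd v) * 2 ^ MG.dist (fst v) a)
      ≡⟨ ∑-*ˡ (MH.stackCost (snd v)) (λ a → 2 ^ MG.dist (fst v) a) ⟩
    MH.stackCost (snd v) * MG.stackCost (fst v)
      ≡⟨ *-comm (MH.stackCost (snd v)) _ ⟩
    MG.stackCost (fst v) * MH.stackCost (snd v) ∎
    where
    open ≡-Reasoning
    module MG = Metric MG
    module MH = Metric MH

  -- The two coordinates of the stacking vertex vary independently, so the maximum of the product is
  -- the product of the maxima.
  □-maxStackCost : ∀ {k l} → MaxStackCost G k → MaxStackCost H l → MaxStackCost (G □ H) (k * l)
  □-maxStackCost {k} {l} SG SH = record
    { metric = □-metric SG.metric SH.metric
    ; bound = λ v → ≤-trans (≤-reflexive (□-stackCost SG.metric SH.metric v)) (*-mono-≤ (SG.bound (fst v)) (SH.bound (snd v)))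
    ; attained = pair a b , trans (□-stackCost SG.metric SH.metric (pair a b))
        (cong₂ _*_ (trans (cong SG.stackCost (fst-pair a b)) (proj₂ SG.attained))
                   (trans (cong SH.stackCost (snd-pair a b)) (proj₂ SH.attained)))
    }
    where
    module SG = MaxStackCost SG
    module SH = MaxStackCost SH
    a = proj₁ SG.attained
    b = proj₁ SH.attained

-- Complete graphs

complete-metric : ∀ n → Metric (Complete n)
complete-metric n = record
  { dist = δ
  ; dist-refl = δ-refl
  ; dist-eq = δ-eq
  ; lipschitz = λ v {u} {w} _ → ≤-trans (δ≤1 v w) (s≤s z≤n)
  ; descent = desc
  }
  where
  δ : Fin n → Fin n → ℕ
  δ x y with x Fin.≟ y
  ... | yes _ = 0
  ... | no  _ = 1
  δ-refl : ∀ x → δ x x ≡ 0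
  δ-refl x with x Fin.≟ x
  ... | yes _  = refl
  ... | no x≢x = contradiction refl x≢x
  δ-eq : ∀ {x y} → δ x y ≡ 0 → x ≡ y
  δ-eq {x} {y} eq with x Fin.≟ y
  ... | yes x≡y = x≡y
  δ≤1 : ∀ x y → δ x y ≤ 1
  δ≤1 x y with x Fin.≟ y
  ... | yes _ = z≤n
  ... | no  _ = ≤-refl
  desc : ∀ {u v k} → δ u v ≡ suc k → ∃ λ w → u ≢ w × δ w v ≡ k
  desc {u} {v} eq with u Fin.≟ v
  desc {u} {v} refl | no u≢v = v , u≢v , δ-refl v

complete₁-maxStackCost : MaxStackCost (Complete 1) 1
complete₁-maxStackCost = record
  { metric = complete-metric 1
  ; bound = λ { Fin.zero → ≤-refl }
  ; attained = Fin.zero , refl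
  }

□-list-maxStackCost : (F : ℕ → Graph) (γ : ℕ → ℕ) → ∀ {ns} → All (λ n → MaxStackCost (F n) (γ n)) ns →
  MaxStackCost (□-list (map F ns)) (product (map γ ns))
□-list-maxStackCost F γ []       = complete₁-maxStackCost
□-list-maxStackCost F γ (S ∷ Ss) = □-maxStackCost S (□-list-maxStackCost F γ Ss)

-- Paths

∣-∣-sucʳ-≤ : ∀ a b → ∣ a - suc b ∣ ≤ suc ∣ a - b ∣
∣-∣-sucʳ-≤ zero    b       = ≤-refl
∣-∣-sucʳ-≤ (suc a) zero    = ≤-trans (≤-reflexive (∣-∣-identityʳ a)) (m≤n+m a 2)
∣-∣-sucʳ-≤ (suc a) (suc b) = ∣-∣-sucʳ-≤ a b

∣-∣-predʳ-≤ : ∀ a b → ∣ a - b ∣ ≤ suc ∣ a - suc b ∣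
∣-∣-predʳ-≤ zero    b       = m≤n+m b 2
∣-∣-predʳ-≤ (suc a) zero    = s≤s (≤-reflexive (sym (∣-∣-identityʳ a)))
∣-∣-predʳ-≤ (suc a) (suc b) = ∣-∣-predʳ-≤ a b

path-descent : ∀ {n} (u v : Fin n) {k} → ∣ toℕ u - toℕ v ∣ ≡ suc k →
  ∃ λ w → (Path n ⊢ u ~ w) × ∣ toℕ w - toℕ v ∣ ≡ k
path-descent {suc (suc n)} Fin.zero (Fin.suc v) eq = Fin.suc Fin.zero , inj₁ refl , suc-injective eq
path-descent (Fin.suc u) Fin.zero eq =
  Fin.inject₁ u , inj₂ (cong suc (Finₚ.toℕ-inject₁ u)) ,
  trans (∣-∣-identityʳ _) (trans (Finₚ.toℕ-inject₁ u) (suc-injective eq))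
path-descent (Fin.suc u) (Fin.suc v) eq with path-descent u v eq
... | w , inj₁ u~w , eq′ = Fin.suc w , inj₁ (cong suc u~w) , eq′
... | w , inj₂ u~w , eq′ = Fin.suc w , inj₂ (cong suc u~w) , eq′

path-metric : ∀ n → Metric (Path n)
path-metric n = record
  { dist = λ i j → ∣ toℕ i - toℕ j ∣
  ; dist-refl = λ i → ∣n-n∣≡0 (toℕ i)
  ; dist-eq = λ eq → Finₚ.toℕ-injective (∣m-n∣≡0⇒m≡n eq)
  ; lipschitz = lip
  ; descent = λ {u} {v} → path-descent u v
  }
  where
  lip : ∀ v {u w} → Path n ⊢ u ~ w → ∣ toℕ v - toℕ w ∣ ≤ suc ∣ toℕ v - toℕ u ∣
  lip v {u} {w} (inj₁ 1+u≡w) = subst (λ z → ∣ toℕ v - z ∣ ≤ suc ∣ toℕ v - toℕ u ∣) 1+u≡w (∣-∣-sucʳ-≤ (toℕ v) (toℕ u))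
  lip v {u} {w} (inj₂ 1+w≡u) = subst (λ z → ∣ toℕ v - toℕ w ∣ ≤ suc ∣ toℕ v - z ∣) 1+w≡u (∣-∣-predʳ-≤ (toℕ v) (toℕ w))

∑-geometric : ∀ n → suc (∑ {n} (λ j → 2 ^ toℕ j)) ≡ 2 ^ n
∑-geometric zero    = refl
∑-geometric (suc n) = trans (cong (suc ∘ suc) (∑-*ˡ 2 (λ j → 2 ^ toℕ {n} j)))
  (trans (double (∑ (λ j → 2 ^ toℕ {n} j))) (cong (2 *_) (∑-geometric n)))
  where
  double : ∀ s → suc (suc (2 * s)) ≡ 2 * suc s
  double = solve-∀

-- Split off vertex 0 of a path on `suc n` vertices: it costs at most `2 ^ n`, and the rest is a
-- path on `n` vertices, costing less than `2 ^ n`.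
path-stackCost : ∀ {n} (i : Fin n) → Metric.stackCost (path-metric n) i < 2 ^ n
path-stackCost {suc n} Fin.zero    = ≤-reflexive (∑-geometric (suc n))
path-stackCost {suc n} (Fin.suc i) = begin-strict
  2 ^ suc (toℕ i) + Metric.stackCost (path-metric n) i  <⟨ +-mono-≤-< (^-monoʳ-≤ 2 (Finₚ.toℕ<n i)) (path-stackCost i) ⟩
  2 ^ n + 2 ^ n                                         ≡⟨ cong (2 ^ n +_) (+-identityʳ (2 ^ n)) ⟨
  2 ^ suc n                                             ∎
  where open ≤-Reasoning

path-maxStackCost : ∀ {n} → 1 ≤ n → MaxStackCost (Path n) (γPath n)
path-maxStackCost {suc n} _ = record
  { metric = path-metric (suc n)
  ; bound = λ v → ∸-monoˡ-≤ 1 (path-stackCost v)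
  ; attained = Fin.zero , cong (_∸ 1) (∑-geometric (suc n))
  }

-- Cycles

∑-last : ∀ {n} (f : Fin (suc n) → ℕ) → ∑ f ≡ ∑ (f ∘ Fin.inject₁) + f (Fin.fromℕ n)
∑-last {zero}  f = +-comm (f Fin.zero) 0
∑-last {suc n} f = trans (cong (f Fin.zero +_) (∑-last (f ∘ Fin.suc))) (sym (+-assoc (f Fin.zero) _ _))

-- The distance on the `m`-cycle between vertices whose indices differ by `a`: the shorter of the
-- two ways round.
arc : ℕ → ℕ → ℕ
arc m a = a ⊓ (m ∸ a)

-- The first bound controls `a`, the second `m ∸ a`, which moves the opposite way.
arc-lipschitz : ∀ m {a b} → a ≤ suc b → b ≤ suc a → arc m a ≤ suc (arc m b)
arc-lipschitz m {a} {b} a≤1+b b≤1+a = ⊓-glb (≤-trans (m⊓n≤m a (m ∸ a)) a≤1+b)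
  (≤-trans (m⊓n≤n a (m ∸ a)) (m≤n+o⇒m∸n≤o m a (begin
    m                ≤⟨ m≤n+m∸n m b ⟩
    b + (m ∸ b)      ≤⟨ +-monoˡ-≤ (m ∸ b) b≤1+a ⟩
    suc a + (m ∸ b)  ≡⟨ +-suc a (m ∸ b) ⟨
    a + suc (m ∸ b)  ∎)))
  where open ≤-Reasoning

arc-short : ∀ m {a} → a + a ≤ m → arc m a ≡ a
arc-short m {a} 2a≤m = m≤n⇒m⊓n≡m (m+n≤o⇒m≤o∸n a 2a≤m)

arc-complement : ∀ {a b} → arc (a + b) a ≡ arc (a + b) b
arc-complement {a} {b} = trans (cong (a ⊓_) (m+n∸m≡n a b)) (trans (⊓-comm a b) (cong (b ⊓_) (sym (m+n∸n≡m a b))))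

module _ (n : ℕ) where

  private
    m = suc n
    δ : Fin m → Fin m → ℕ
    δ i j = arc m ∣ toℕ i - toℕ j ∣

    path⇒cycle : ∀ {u w} → Path m ⊢ u ~ w → Cycle m ⊢ u ~ w
    path⇒cycle (inj₁ eq) = inj₁ (inj₁ eq)
    path⇒cycle (inj₂ eq) = inj₂ (inj₁ eq)

    ∣-∣<m : ∀ (i j : Fin m) → ∣ toℕ i - toℕ j ∣ < m
    ∣-∣<m i j = ≤-trans (s≤s (∣m-n∣≤m⊔n (toℕ i) (toℕ j))) (⊔-lub (Finₚ.toℕ<n i) (Finₚ.toℕ<n j))

    -- The closing edge joins `a`, the last vertex, to 0. The two arguments of `arc` are
    -- complementary in `m`, so across this edge 0 behaves like a successor of `a`.
    around : ∀ {a} (v : Fin m) → suc a ≡ m → arc m ∣ toℕ v - 0 ∣ ≡ arc m (suc ∣ toℕ v - a ∣)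
    around {a} v refl = trans (cong (arc m) (∣-∣-identityʳ (toℕ v)))
      (subst (λ s → arc s (toℕ v) ≡ arc s (suc ∣ toℕ v - n ∣))
        (trans (cong (toℕ v +_) (cong suc ∣v-n∣)) (trans (+-suc (toℕ v) _) (cong suc (m+[n∸m]≡n v≤n))))
        (arc-complement {toℕ v}))
      where
      v≤n : toℕ v ≤ n
      v≤n = s≤s⁻¹ (Finₚ.toℕ<n v)
      ∣v-n∣ : ∣ toℕ v - n ∣ ≡ n ∸ toℕ v
      ∣v-n∣ = m≤n⇒∣m-n∣≡n∸m v≤n

    step-lipschitz : ∀ v {u w} → Cycle m ⊢ u ~ w → δ v w ≤ suc (δ v u)
    step-lipschitz v {u} {w} (inj₁ (inj₁ 1+u≡w)) rewrite sym 1+u≡w =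
      arc-lipschitz m (∣-∣-sucʳ-≤ (toℕ v) (toℕ u)) (∣-∣-predʳ-≤ (toℕ v) (toℕ u))
    step-lipschitz v {u} {w} (inj₂ (inj₁ 1+w≡u)) rewrite sym 1+w≡u =
      arc-lipschitz m (∣-∣-predʳ-≤ (toℕ v) (toℕ w)) (∣-∣-sucʳ-≤ (toℕ v) (toℕ w))
    step-lipschitz v {u} {w} (inj₁ (inj₂ (1+u≡m , w≡0))) rewrite w≡0 | around v 1+u≡m =
      arc-lipschitz m ≤-refl (m≤n+m _ 2)
    step-lipschitz v {u} {w} (inj₂ (inj₂ (1+w≡m , u≡0))) rewrite u≡0 | around v 1+w≡m =
      arc-lipschitz m (m≤n+m _ 2) ≤-refl

    -- If the long way round is the shorter one, moving away from v decreases the distance.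
    away : ∀ (u v : Fin m) {k} → m ≡ suc k + ∣ toℕ u - toℕ v ∣ → ∃ λ w → (Cycle m ⊢ u ~ w) ×
      (∣ toℕ w - toℕ v ∣ ≡ suc ∣ toℕ u - toℕ v ∣ ⊎ ∣ toℕ w - toℕ v ∣ ≡ k)
    away u v {k} m≡ with ≤-total (toℕ u) (toℕ v)
    away Fin.zero v {k} m≡ | inj₁ _ = Fin.fromℕ n , inj₂ (inj₂ (cong suc (Finₚ.toℕ-fromℕ n) , refl)) , inj₂ (begin
      ∣ toℕ (Fin.fromℕ n) - toℕ v ∣  ≡⟨ cong (∣_- toℕ v ∣) (Finₚ.toℕ-fromℕ n) ⟩
      ∣ n - toℕ v ∣                  ≡⟨ cong (∣_- toℕ v ∣) (suc-injective m≡) ⟩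
      ∣ k + toℕ v - toℕ v ∣          ≡⟨ m≤n⇒∣n-m∣≡n∸m (m≤n+m (toℕ v) k) ⟩
      k + toℕ v ∸ toℕ v              ≡⟨ m+n∸n≡m k (toℕ v) ⟩
      k                              ∎)
      where open ≡-Reasoning
    away (Fin.suc u) v {k} m≡ | inj₁ u<v = Fin.inject₁ u , inj₂ (inj₁ (cong suc (Finₚ.toℕ-inject₁ u))) , inj₁ (begin
      ∣ toℕ (Fin.inject₁ u) - toℕ v ∣  ≡⟨ cong (∣_- toℕ v ∣) (Finₚ.toℕ-inject₁ u) ⟩
      ∣ toℕ u - toℕ v ∣                ≡⟨ m≤n⇒∣m-n∣≡n∸m (<⇒≤ u<v) ⟩
      toℕ v ∸ toℕ u                    ≡⟨ +-∸-assoc 1 u<v ⟩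
      suc (toℕ v ∸ suc (toℕ u))        ≡⟨ cong suc (m≤n⇒∣m-n∣≡n∸m u<v) ⟨
      suc ∣ suc (toℕ u) - toℕ v ∣      ∎)
      where open ≡-Reasoning
    away u v {k} m≡ | inj₂ v≤u with suc (toℕ u) <? m
    ... | yes 1+u<m = Fin.fromℕ< 1+u<m , inj₁ (inj₁ (sym (Finₚ.toℕ-fromℕ< 1+u<m))) , inj₁ (begin
      ∣ toℕ (Fin.fromℕ< 1+u<m) - toℕ v ∣  ≡⟨ cong (∣_- toℕ v ∣) (Finₚ.toℕ-fromℕ< 1+u<m) ⟩
      ∣ suc (toℕ u) - toℕ v ∣             ≡⟨ m≤n⇒∣n-m∣≡n∸m (m≤n⇒m≤1+n v≤u) ⟩
      suc (toℕ u) ∸ toℕ v                 ≡⟨ +-∸-assoc 1 v≤u ⟩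
      suc (toℕ u ∸ toℕ v)                 ≡⟨ cong suc (m≤n⇒∣n-m∣≡n∸m v≤u) ⟨
      suc ∣ toℕ u - toℕ v ∣               ∎)
      where open ≡-Reasoning
    ... | no 1+u≮m = Fin.zero , inj₁ (inj₂ (1+u≡m , refl)) , inj₂ (+-cancelʳ-≡ (toℕ u ∸ toℕ v) _ _ (begin
      toℕ v + (toℕ u ∸ toℕ v)  ≡⟨ m+[n∸m]≡n v≤u ⟩
      toℕ u                    ≡⟨ suc-injective (trans 1+u≡m m≡) ⟩
      k + ∣ toℕ u - toℕ v ∣    ≡⟨ cong (k +_) (m≤n⇒∣n-m∣≡n∸m v≤u) ⟩
      k + (toℕ u ∸ toℕ v)      ∎))
      where
      open ≡-Reasoning
      1+u≡m : suc (toℕ u) ≡ m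
      1+u≡m = ≤-antisym (Finₚ.toℕ<n u) (≮⇒≥ 1+u≮m)

    step-descent : ∀ {u v k} → δ u v ≡ suc k → ∃ λ w → (Cycle m ⊢ u ~ w) × δ w v ≡ k
    step-descent {u} {v} {k} eq with ≤-total ∣ toℕ u - toℕ v ∣ (m ∸ ∣ toℕ u - toℕ v ∣)
    ... | inj₁ short =
      let a≡1+k = trans (sym (m≤n⇒m⊓n≡m short)) eq
          w , u~w , wv≡k = path-descent u v a≡1+k
          2[1+k]≤m = subst (λ a → a + a ≤ m) a≡1+k
            (≤-trans (+-monoʳ-≤ _ short) (≤-reflexive (m+[n∸m]≡n (<⇒≤ (∣-∣<m u v)))))
      in w , path⇒cycle u~w ,
         trans (cong (arc m) wv≡k) (arc-short m (≤-trans (+-mono-≤ (n≤1+n k) (n≤1+n k)) 2[1+k]≤m))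
    ... | inj₂ long = finish (away u v m≡)
      where
      a = ∣ toℕ u - toℕ v ∣
      m∸a≡1+k : m ∸ a ≡ suc k
      m∸a≡1+k = trans (sym (m≥n⇒m⊓n≡n long)) eq
      m≡ : m ≡ suc k + a
      m≡ = trans (sym (m∸n+n≡m (<⇒≤ (∣-∣<m u v)))) (cong (_+ a) m∸a≡1+k)
      k+k≤m : k + k ≤ m
      k+k≤m = ≤-trans (+-mono-≤ (n≤1+n k) (≤-trans (n≤1+n k) (subst (_≤ a) m∸a≡1+k long))) (≤-reflexive (sym m≡))
      m≡′ : k + suc a ≡ m
      m≡′ = trans (+-suc k a) (sym m≡)
      finish : (∃ λ w → (Cycle m ⊢ u ~ w) × (∣ toℕ w - toℕ v ∣ ≡ suc a ⊎ ∣ toℕ w - toℕ v ∣ ≡ k)) →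
        ∃ λ w → (Cycle m ⊢ u ~ w) × δ w v ≡ k
      finish (w , u~w , inj₂ wv≡k) = w , u~w , trans (cong (arc m) wv≡k) (arc-short m k+k≤m)
      -- `suc a` and `k` add up to `m`, so they have the same arc.
      finish (w , u~w , inj₁ wv≡1+a) = w , u~w , trans (cong (arc m) wv≡1+a)
        (trans (subst (λ s → arc s (suc a) ≡ arc s k) m≡′ (sym (arc-complement {k}))) (arc-short m k+k≤m))

  cycle-metric : Metric (Cycle m)
  cycle-metric = record
    { dist = δ
    ; dist-refl = λ i → cong (arc m) (∣n-n∣≡0 (toℕ i))
    ; dist-eq = λ {i} {j} → zero-arc i j
    ; lipschitz = step-lipschitz
    ; descent = step-descent
    }
    where
    zero-arc : ∀ i j → δ i j ≡ 0 → i ≡ j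
    zero-arc i j eq with ⊓-sel ∣ toℕ i - toℕ j ∣ (m ∸ ∣ toℕ i - toℕ j ∣)
    ... | inj₁ sel = Finₚ.toℕ-injective (∣m-n∣≡0⇒m≡n (trans (sym sel) eq))
    ... | inj₂ sel = contradiction (trans (sym sel) eq) (m<n⇒n≢0 (m<n⇒0<n∸m (∣-∣<m i j)))

  private
    cost : ℕ → ℕ
    cost i = ∑ {m} (λ j → 2 ^ arc m ∣ i - toℕ j ∣)

    -- Rotational symmetry: the first term for `suc i` equals the last term for `i`, and the others
    -- are merely shifted.
    cost-suc : ∀ i → i < n → cost (suc i) ≡ cost i
    cost-suc i i<n = begin
      2 ^ arc m (suc i) + ∑ {n} (λ j → 2 ^ arc m ∣ i - toℕ j ∣)
        ≡⟨ +-comm (2 ^ arc m (suc i)) _ ⟩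
      ∑ {n} (λ j → 2 ^ arc m ∣ i - toℕ j ∣) + 2 ^ arc m (suc i)
        ≡⟨ cong₂ (λ a b → a + 2 ^ b)
             (∑-cong {n} (λ j → cong (λ z → 2 ^ arc m ∣ i - z ∣) (sym (Finₚ.toℕ-inject₁ j)))) wrap ⟩
      ∑ {n} (λ j → 2 ^ arc m ∣ i - toℕ (Fin.inject₁ j) ∣) + 2 ^ arc m ∣ i - toℕ (Fin.fromℕ n) ∣
        ≡⟨ ∑-last (λ j → 2 ^ arc m ∣ i - toℕ j ∣) ⟨
      cost i ∎
      where
      open ≡-Reasoning
      wrap : arc m (suc i) ≡ arc m ∣ i - toℕ (Fin.fromℕ n) ∣
      wrap = trans (subst (λ s → arc s (suc i) ≡ arc s (n ∸ i)) (cong suc (m+[n∸m]≡n (<⇒≤ i<n))) (arc-complement {suc i}))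
        (cong (arc m) (trans (sym (m≤n⇒∣m-n∣≡n∸m (<⇒≤ i<n))) (cong (∣ i -_∣) (sym (Finₚ.toℕ-fromℕ n)))))

    cost-const : ∀ i → i ≤ n → cost i ≡ cost 0
    cost-const zero    _   = refl
    cost-const (suc i) i<n = trans (cost-suc i i<n) (cost-const i (<⇒≤ i<n))

  cycle-stackCost : ∀ i → Metric.stackCost cycle-metric i ≡ ∑ {m} (λ j → 2 ^ arc m (toℕ j))
  cycle-stackCost i = cost-const (toℕ i) (s≤s⁻¹ (Finₚ.toℕ<n i))

∑-geometric-down : ∀ n → 2 + ∑ {n} (λ j → 2 ^ (n ∸ toℕ j)) ≡ 2 ^ suc n
∑-geometric-down zero    = refl
∑-geometric-down (suc n) = trans (x∙yz≈y∙xz 2 (2 ^ suc n) (∑ {n} (λ j → 2 ^ (n ∸ toℕ j))))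
  (trans (cong (2 ^ suc n +_) (∑-geometric-down n)) (cong (2 ^ suc n +_) (sym (+-identityʳ _))))

-- From vertex 0 the first `suc s` vertices lie at distances 0 to `s`, the others at `r` down to 1.
-- The two geometric sums fall short of powers of two by 1 and 2, whence the 3.
∑-arc : ∀ s r → s ≤ suc r → r ≤ s → 3 + ∑ {suc s + r} (λ j → 2 ^ arc (suc s + r) (toℕ j)) ≡ 2 ^ suc r + 2 ^ suc s
∑-arc s r s≤1+r r≤s = begin
  3 + ∑ {m} (λ j → 2 ^ arc m (toℕ j))
    ≡⟨ cong (3 +_) (∑-++ (suc s) (λ j → 2 ^ arc m (toℕ j))) ⟩
  3 + (∑ {suc s} (λ j → 2 ^ arc m (toℕ (j Fin.↑ˡ r))) + ∑ {r} (λ j → 2 ^ arc m (toℕ (suc s Fin.↑ʳ j))))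
    ≡⟨ cong (3 +_) (cong₂ _+_ (∑-cong (cong (2 ^_) ∘ near)) (∑-cong (cong (2 ^_) ∘ far))) ⟩
  3 + (∑ {suc s} (λ j → 2 ^ toℕ j) + ∑ {r} (λ j → 2 ^ (r ∸ toℕ j)))
    ≡⟨ regroup (∑ {suc s} (λ j → 2 ^ toℕ j)) _ ⟩
  (2 + ∑ {r} (λ j → 2 ^ (r ∸ toℕ j))) + suc (∑ {suc s} (λ j → 2 ^ toℕ j))
    ≡⟨ cong₂ _+_ (∑-geometric-down r) (∑-geometric (suc s)) ⟩
  2 ^ suc r + 2 ^ suc s ∎
  where
  open ≡-Reasoning
  m = suc s + r
  regroup : ∀ a b → 3 + (a + b) ≡ (2 + b) + suc a
  regroup = solve-∀
  near : ∀ (j : Fin (suc s)) → arc m (toℕ (j Fin.↑ˡ r)) ≡ toℕ j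
  near j = trans (cong (arc m) (Finₚ.toℕ-↑ˡ j r))
    (arc-short m (≤-trans (+-mono-≤ j≤s (≤-trans j≤s s≤1+r)) (≤-reflexive (+-suc s r))))
    where
    j≤s : toℕ j ≤ s
    j≤s = s≤s⁻¹ (Finₚ.toℕ<n j)
  far : ∀ (j : Fin r) → arc m (toℕ (suc s Fin.↑ʳ j)) ≡ r ∸ toℕ j
  far j = trans (cong (arc m) (Finₚ.toℕ-↑ʳ (suc s) j))
    (trans (cong ((suc s + toℕ j) ⊓_) ([m+n]∸[m+o]≡n∸o (suc s) r (toℕ j)))
      (m≥n⇒m⊓n≡n (≤-trans (m∸n≤m r (toℕ j)) (≤-trans r≤s (≤-trans (n≤1+n s) (m≤m+n (suc s) (toℕ j)))))))

∑-arc-γCycle : ∀ m → 1 ≤ m → ∑ {m} (λ j → 2 ^ arc m (toℕ j)) ≡ γCycle m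
∑-arc-γCycle m 1≤m with ⌈ m /2⌉ in r≡
... | zero = contradiction (≤-trans (⌈n/2⌉-mono 1≤m) (≤-reflexive r≡)) λ ()
... | suc r = begin
  ∑ {m} (λ j → 2 ^ arc m (toℕ j))      ≡⟨ cong (_∸ 3) (subst (λ k → 3 + ∑ {k} (λ j → 2 ^ arc k (toℕ j)) ≡ 2 ^ suc r + 2 ^ suc s) (sym m≡) (∑-arc s r s≤1+r r≤s)) ⟩
  2 ^ suc r + 2 ^ suc s ∸ 3            ≡⟨ cong (λ k → 2 ^ suc r + 2 ^ k ∸ 3) (trans (+-comm 1 s) (cong (_+ 1) (sym m∸r))) ⟩
  2 ^ suc r + 2 ^ (m ∸ suc r + 1) ∸ 3  ∎
  where
  open ≡-Reasoning
  s = ⌊ m /2⌋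
  s+1+r≡m : s + suc r ≡ m
  s+1+r≡m = trans (cong (s +_) (sym r≡)) (⌊n/2⌋+⌈n/2⌉≡n m)
  m≡ : m ≡ suc s + r
  m≡ = trans (sym s+1+r≡m) (+-suc s r)
  m∸r : m ∸ suc r ≡ s
  m∸r = trans (cong (_∸ suc r) (sym s+1+r≡m)) (m+n∸n≡m s (suc r))
  s≤1+r : s ≤ suc r
  s≤1+r = ≤-trans (⌊n/2⌋≤⌈n/2⌉ m) (≤-reflexive r≡)
  r≤s : r ≤ s
  -- `⌈ m /2⌉` unfolds to `⌊ suc m /2⌋`, and `⌊ suc (suc m) /2⌋` to `suc s`.
  r≤s = s≤s⁻¹ (≤-trans (≤-reflexive (sym r≡)) (⌊n/2⌋-mono (n≤1+n (suc m))))

cycle-maxStackCost : ∀ {m} → 3 ≤ m → MaxStackCost (Cycle m) (γCycle m)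
cycle-maxStackCost {suc n} _ = record
  { metric = cycle-metric n
  ; bound = λ v → ≤-reflexive (cost v)
  ; attained = Fin.zero , cost Fin.zero
  }
  where
  cost : ∀ v → Metric.stackCost (cycle-metric n) v ≡ γCycle (suc n)
  cost v = trans (cycle-stackCost n v) (∑-arc-γCycle (suc n) (s≤s z≤n))

-- Connected graphs with decidable adjacency

least : {P : ℕ → Set} → (∀ k → Dec (P k)) → ∀ k → P k → ∃ λ l → P l × (∀ i → P i → l ≤ i)
least P? zero    p = 0 , p , λ _ _ → z≤n
least P? (suc k) p with P? 0
... | yes p₀ = 0 , p₀ , λ _ _ → z≤n
... | no ¬p₀ with least (P? ∘ suc) k p
...   | l , q , min = suc l , q , λ { zero p₀ → contradiction p₀ ¬p₀ ; (suc i) pᵢ → s≤s (min i pᵢ) }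

module _ {G : Graph} where

  private V = Fin (size G)

  Walk : ℕ → V → V → Set
  Walk zero    u v = u ≡ v
  Walk (suc k) u v = ∃ λ w → (G ⊢ u ~ w) × Walk k w v

  walk-snoc : ∀ k {u v w} → Walk k u v → G ⊢ v ~ w → Walk (suc k) u w
  walk-snoc zero    refl            v~w = _ , v~w , refl
  walk-snoc (suc k) (x , u~x , walk) v~w = x , u~x , walk-snoc k walk v~w

  star⇒walk : ∀ {u v} → Star (_~_ G) u v → ∃ λ k → Walk k u v
  star⇒walk ε = 0 , refl
  star⇒walk (u~w ◅ ws) = let k , walk = star⇒walk ws in suc k , _ , u~w , walk

  -- The distance is the least length of a walk. Connectedness supplies some length, and decidable
  -- adjacency on finitely many vertices makes the search for the least one effective.
  connected-metric : (∀ u v → Dec (G ⊢ u ~ v)) → Connected G → Metric G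
  connected-metric adj? connected = record
    { dist = δ
    ; dist-refl = λ x → n≤0⇒n≡0 (minimal 0 refl)
    ; dist-eq = λ {x} {y} eq → subst (λ k → Walk k x y) eq (geodesic x y)
    ; lipschitz = λ v {u} {w} u~w → minimal (suc (δ v u)) (walk-snoc (δ v u) (geodesic v u) u~w)
    ; descent = λ {u} {v} {k} eq →
        let w , u~w , walk = subst (λ l → Walk l u v) eq (geodesic u v)
        in w , u~w , ≤-antisym (minimal k walk)
             (s≤s⁻¹ (subst (_≤ suc (δ w v)) eq (minimal (suc (δ w v)) (w , u~w , geodesic w v))))
    }
    where
    walk? : ∀ k u v → Dec (Walk k u v)
    walk? zero    u v = u Fin.≟ v
    walk? (suc k) u v = any? (λ w → adj? u w ×-dec walk? k w v)
    shortest : ∀ u v → ∃ λ l → Walk l u v × (∀ i → Walk i u v → l ≤ i)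
    shortest u v = let k , walk = star⇒walk (connected u v) in least (λ k → walk? k u v) k walk
    δ : V → V → ℕ
    δ u v = proj₁ (shortest u v)
    geodesic : ∀ u v → Walk (δ u v) u v
    geodesic u v = proj₁ (proj₂ (shortest u v))
    minimal : ∀ {u v} i → Walk i u v → δ u v ≤ i
    minimal {u} {v} = proj₂ (proj₂ (shortest u v))

-- Trees

module _ {G : Graph} where

  open DecMembership (Fin._≟_ {size G}) using (_∈?_)
  private V = Fin (size G)

  data SimplePath (v : V) : V → List V → Set where
    stop : SimplePath v v (v ∷ [])
    step : ∀ {u w ws} → G ⊢ u ~ w → u ∉ ws → SimplePath v w ws → SimplePath v u (u ∷ ws)

  cut : ∀ {u v w ws} → u ∈ ws → SimplePath v w ws → ∃ (SimplePath v u)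
  cut (here refl)   stop             = _ , stop
  cut (here refl)   p@(step _ _ _)   = _ , p
  cut (there u∈ws) (step _ _ p)      = cut u∈ws p

  -- Loop erasure: when the new first vertex already occurs, the path is cut back to that
  -- occurrence.
  simplify : ∀ {u v} → Star (_~_ G) u v → ∃ (SimplePath v u)
  simplify ε = _ , stop
  simplify {u} (u~w ◅ ps) with simplify ps
  ... | ws , p with u ∈? ws
  ...   | yes u∈ws = cut u∈ws p
  ...   | no  u∉ws = u ∷ ws , step u~w u∉ws p

  lookup-injective : ∀ {u v ws} → SimplePath v u ws → ∀ {i j} → lookup ws i ≡ lookup ws j → i ≡ j
  lookup-injective stop {Fin.zero} {Fin.zero} _ = refl
  lookup-injective (step _ _ _) {Fin.zero} {Fin.zero} _ = refl
  lookup-injective (step {ws = ws} _ u∉ws _) {Fin.zero} {Fin.suc j} eq =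
    contradiction (subst (_∈ ws) (sym eq) (∈-lookup j)) u∉ws
  lookup-injective (step {ws = ws} _ u∉ws _) {Fin.suc i} {Fin.zero} eq =
    contradiction (subst (_∈ ws) eq (∈-lookup i)) u∉ws
  lookup-injective (step _ _ p) {Fin.suc i} {Fin.suc j} eq = cong Fin.suc (lookup-injective p eq)

  lookup-adjacent : ∀ {u v x ws} → SimplePath v u (x ∷ ws) → ∀ i →
    G ⊢ lookup (x ∷ ws) (Fin.inject₁ i) ~ lookup ws i
  lookup-adjacent (step u~w _ stop)           Fin.zero    = u~w
  lookup-adjacent (step u~w _ (step _ _ _))   Fin.zero    = u~w
  lookup-adjacent (step _ _ p@(step _ _ _))   (Fin.suc i) = lookup-adjacent p i

  lookup-last : ∀ {u v x ws} → SimplePath v u (x ∷ ws) → lookup (x ∷ ws) (Fin.fromℕ (length ws)) ≡ v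
  lookup-last stop                     = refl
  lookup-last (step _ _ stop)          = refl
  lookup-last (step _ _ p@(step _ _ _)) = lookup-last p

  -- The three exposed entries ensure the length `3 + k` that `HasCycle` asks for.
  closeUp : ∀ {u v x y z zs} → SimplePath v u (x ∷ y ∷ z ∷ zs) → G ⊢ v ~ x → HasCycle G
  closeUp {x = x} p v~x =
    _ , lookup _ , lookup-injective p , lookup-adjacent p , subst (G ⊢_~ x) (sym (lookup-last p)) v~x

  -- A simple path decides whether its ends are adjacent: with two or more edges, an extra edge would close a cycle.
  tree-adjacent? : IsTree G → ∀ u v → Dec (G ⊢ u ~ v)
  tree-adjacent? (_ , (sym~ , irrefl~) , connected , acyclic) u v with simplify (connected u v)
  ... | _ , stop                                  = no (irrefl~ u)
  ... | _ , step u~v _ stop                       = yes u~v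
  ... | _ , p@(step _ _ (step _ _ stop))          = no (acyclic ∘ closeUp p ∘ sym~ u v)
  ... | _ , p@(step _ _ (step _ _ (step _ _ _)))  = no (acyclic ∘ closeUp p ∘ sym~ u v)

  -- Adjacency in a `Graph` is an arbitrary family of types; acyclicity provides the decision
  -- procedure for it.
  tree-metric : IsTree G → Metric G
  tree-metric tree@(_ , _ , connected , _) = connected-metric (tree-adjacent? tree) connected

-- Products of paths and cycles, alone and with a tree or a complete graph.

theorem4p5 : (ns ms : List ℕ) → All (1 ≤_) ns → All (3 ≤_) ms → 1 ≤ length ns + length ms →
    ((IsCoverPebblingNumber (Hgraph ns ms) (product (map γPath ns) * product (map γCycle ms))
    × All (λ n → IsCoverPebblingNumber (Path n) (γPath n)) ns
    × All (λ m → IsCoverPebblingNumber (Cycle m) (γCycle m)) ms)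
    × (∀ (T : Graph) (c : ℕ) → IsTree T → IsCoverPebblingNumber T c →
    IsCoverPebblingNumber (Hgraph ns ms □ T) (product (map γPath ns) * product (map γCycle ms) * c))
    × (∀ (n c : ℕ) → 1 ≤ n → IsCoverPebblingNumber (Complete n) c →
    IsCoverPebblingNumber (Hgraph ns ms □ Complete n) (product (map γPath ns) * product (map γCycle ms) * c)))
theorem4p5 ns ms ns≥1 ms≥3 _ =
  ( coverPebblingTheorem H
  , All.map (coverPebblingTheorem ∘ path-maxStackCost) ns≥1
  , All.map (coverPebblingTheorem ∘ cycle-maxStackCost) ms≥3 )
  , (λ T c tree γT → coverPebblingTheorem (□-maxStackCost H (coverPebblingTheorem⁻¹ (tree-metric tree) (proj₁ tree) γT)))
  , (λ n c n≥1 γK → coverPebblingTheorem (□-maxStackCost H (coverPebblingTheorem⁻¹ (complete-metric n) n≥1 γK)))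
  where
  H : MaxStackCost (Hgraph ns ms) (product (map γPath ns) * product (map γCycle ms))
  H = □-maxStackCost (□-list-maxStackCost Path γPath (All.map path-maxStackCost ns≥1))
                     (□-list-maxStackCost Cycle γCycle (All.map cycle-maxStackCost ms≥3))
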